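{- Let $k\geq 1$ be an integer and let $q=2^{k-1}$. For every $r\geq 9$, every $r$-robust strategy for searching on the line with untrusted advice of size $k$ has consistency at least $$1+2\,\frac{b_r^{1/q}}{b_r-1}.$$
   Context: The line is viewed as two unbounded rays, indexed $0$ and $1$, with common endpoint $O$ (the origin). A (single-searcher) search strategy is an infinite sequence $X=(x_i,u_i)_i$ with $x_i\in\mathbb{R}^+$ and $u_i\in\{0,1\}$: in iteration $i$ a unit-speed searcher starts from $O$, walks on ray $u_i$ up to distance $x_i$ from $O$, returns to $O$, and continues with iteration $i+1$, until the target is located. For a target $t$, $d(t)$ is its distance from $O$, and $d(X,t)$ is the total distance walked until the searcher first reaches $t$ (so $d(X,t)=d(t)+2\sum_{j<i}x_j$, where $i$ is the first iteration reaching $t$; $d(X,t)=\infty$ if $t$ is never reached). Standing assumption: targets are at distance at least some fixed constant $d_0>0$ from $O$. The competitive ratio of $X$ is $\sup_t d(X,t)/d(t)$. A strategy with untrusted advice of size $k$ (a $k$-bit string) consists of an assignment of a correct advice string $A(t)\in\{0,1\}^k$ to each target $t$ (the correct answers to $k$ binary queries about $t$), together with a search strategy $X_h$ for every $h\in\{0,1\}^k$, followed by the searcher when the given advice is $h$. Its consistency is its competitive ratio with error-free advice, $\sup_t d(X_{A(t)},t)/d(t)$. Its robustness is its competitive ratio with adversarial advice, $\sup_t\max_h d(X_h,t)/d(t)$. It is $r$-robust if its robustness is at most $r$. For $r\ge 9$, let $\rho_r=(r-1)/2$ and let $b_r$ be the largest real root of $\frac{x^2}{x-1}-\rho_r=0$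 (equivalently, the largest $b>1$ for which the geometric strategy $x_i=b^i$, alternating between the two rays, has competitive ratio $1+2b^2/(b-1)\le r$). -}

module Defs where

open import Level using (0ℓ)
open import Algebra.Bundles using (CommutativeRing; Semiring)
open import Algebra.Structures using (IsCommutativeRing)
open import Algebra.Definitions.RawSemiring using (_^_; sum) renaming (_×_ to _·_)
open import Axiom.ExcludedMiddle using (ExcludedMiddle)
open import Data.Bool.Base using (Bool; false)
open import Data.Fin.Base using (Fin; toℕ)
open import Data.Maybe.Base using (map)
open import Data.Nat.Base as ℕ using (ℕ)
open import Data.Product.Base using (_×_; _,_; ∃; ∃-syntax; proj₁)
open import Data.Vec.Base using (Vec; replicate)
open import Relation.Binary.Core using (Rel)
open import Relation.Binary.Structures using (IsTotalOrder)
import Relation.Binary.Construct.Add.Supremum.NonStrict as AddTop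
import Relation.Binary.Construct.NonStrictToStrict as ToStrict
open import Relation.Binary.PropositionalEquality using (_≡_; _≢_; refl; subst; sym)
open import Relation.Nullary using (¬_; Dec; yes; no; contradiction)
open import Relation.Nullary.Construct.Add.Supremum using (_⁺; ⊤⁺; [_])
open import Relation.Unary using (Pred)

module _ {A : Set} (_≤_ : Rel A 0ℓ) where

  IsUpperBound : Pred A 0ℓ → Pred A 0ℓ
  IsUpperBound P u = ∀ {x} → P x → x ≤ u

  IsGreatest : Pred A 0ℓ → Pred A 0ℓ
  IsGreatest P m = P m × IsUpperBound P m

  IsLeastUpperBound : Pred A 0ℓ → Pred A 0ℓ
  IsLeastUpperBound P s = IsUpperBound P s × (∀ {u} → IsUpperBound P u → s ≤ u)

-- The library has no real numbers. They are characterised here, classically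
-- and up to unique isomorphism, as a Dedekind-complete ordered field.
-- Nothing is assumed about the value of 0# ⁻¹.
record CompleteOrderedField : Set₁ where
  infix  4 _≤_
  infixl 6 _+_ _-_
  infixl 7 _*_ _/_
  infix  8 -_
  infix  9 _⁻¹
  field
    Carrier           : Set
    _+_ _*_           : Carrier → Carrier → Carrier
    -_ _⁻¹            : Carrier → Carrier
    0# 1#             : Carrier
    _≤_               : Rel Carrier 0ℓ
    isCommutativeRing : IsCommutativeRing _≡_ _+_ _*_ -_ 0# 1#
    0≢1               : 0# ≢ 1#
    ⁻¹-inverse        : ∀ {x} → x ≢ 0# → x * x ⁻¹ ≡ 1#
    isTotalOrder      : IsTotalOrder _≡_ _≤_
    +-mono-≤          : ∀ {x y} z → x ≤ y → x + z ≤ y + z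
    *-nonneg          : ∀ {x y} → 0# ≤ x → 0# ≤ y → 0# ≤ x * y
    complete          : (P : Pred Carrier 0ℓ) → ∃ P → ∃ (IsUpperBound _≤_ P) →
                        ∃ (IsLeastUpperBound _≤_ P)

  commutativeRing : CommutativeRing 0ℓ 0ℓ
  commutativeRing = record { isCommutativeRing = isCommutativeRing }

  open CommutativeRing commutativeRing public using (semiring)
  open Semiring semiring using (rawSemiring)
  open ToStrict _≡_ _≤_ public using (_<_)

  _-_ : Carrier → Carrier → Carrier
  x - y = x + - y

  _/_ : Carrier → Carrier → Carrier
  x / y = x * y ⁻¹

  infixr 8 _^ʳ_
  _^ʳ_ : Carrier → ℕ → Carrier
  _^ʳ_ = _^_ rawSemiring

  fromℕ : ℕ → Carrier
  fromℕ n = _·_ rawSemiring n 1#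

  ∑< : ℕ → (ℕ → Carrier) → Carrier
  ∑< n f = sum rawSemiring {n} (λ j → f (toℕ j))

-- Excluded middle serves to define the distance d (X , t) and the suprema
-- below as total functions with values in ℝ ∪ {∞}.
module Search (em : ExcludedMiddle 0ℓ) (R : CompleteOrderedField) where
  open CompleteOrderedField R public renaming (Carrier to ℝ)
  open AddTop _≤_ public using (_≤⁺_; _≤⊤⁺) renaming ([_] to [_]≤)

  ℝ∞ : Set
  ℝ∞ = ℝ ⁺

  Range : {I : Set} → (I → ℝ∞) → Pred ℝ∞ 0ℓ
  Range f y = ∃[ i ] f i ≡ y

  sup-exists : {I : Set} → I → (f : I → ℝ∞) → ∃ (IsLeastUpperBound _≤⁺_ (Range f))
  sup-exists {I} i₀ f = cases em
    where
    Bounded : Set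
    Bounded = ∃[ M ] (∀ i → f i ≤⁺ [ M ])

    cases : Dec Bounded → ∃ (IsLeastUpperBound _≤⁺_ (Range f))
    cases (no unbounded) = ⊤⁺ , (λ {y} _ → y ≤⊤⁺) , λ {u} ub → top u ub
      where
      top : ∀ u → IsUpperBound _≤⁺_ (Range f) u → ⊤⁺ ≤⁺ u
      top ⊤⁺    ub = ⊤⁺ ≤⊤⁺
      top [ M ] ub = contradiction (M , λ i → ub (i , refl)) unbounded
    cases (yes (M , f≤M)) = [ s ] , upper , least
      where
      P : Pred ℝ 0ℓ
      P x = ∃[ i ] f i ≡ [ x ]

      finite : ∀ y → y ≤⁺ [ M ] → ∃[ x ] y ≡ [ x ] × x ≤ M
      finite [ x ] [ p ]≤ = x , refl , p

      nonempty : ∃ P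
      nonempty with finite (f i₀) (f≤M i₀)
      ... | x , eq , _ = x , i₀ , eq

      boundedBy : IsUpperBound _≤_ P M
      boundedBy {x} (i , eq) with subst (_≤⁺ [ M ]) eq (f≤M i)
      ... | [ p ]≤ = p

      lub : ∃ (IsLeastUpperBound _≤_ P)
      lub = complete P nonempty (M , boundedBy)

      s : ℝ
      s = proj₁ lub

      upper : IsUpperBound _≤⁺_ (Range f) [ s ]
      upper {y} (i , refl) with finite (f i) (f≤M i) | lub
      ... | x , eq , _ | _ , ub , _ = subst (_≤⁺ _) (sym eq) [ ub (i , eq) ]≤

      least : ∀ {u} → IsUpperBound _≤⁺_ (Range f) u → [ s ] ≤⁺ u
      least {⊤⁺}    ub = [ s ] ≤⊤⁺
      least {[ m ]} ub with lub
      ... | _ , _ , min = [ min bound ]≤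
        where
        bound : IsUpperBound _≤_ P m
        bound {x} p with ub p
        ... | [ q ]≤ = q

  -- The first argument records that the index set is inhabited.
  sup : {I : Set} → I → (I → ℝ∞) → ℝ∞
  sup i₀ f = proj₁ (sup-exists i₀ f)

  record Strategy : Set where
    field
      x     : ℕ → ℝ
      u     : ℕ → Fin 2
      x-pos : ∀ i → 0# < x i

  record Target (d₀ : ℝ) : Set where
    constructor target
    field
      ray  : Fin 2
      dist : ℝ
      far  : d₀ ≤ dist

  module _ {d₀ : ℝ} where
    open Strategy
    open Target

    Reaches : Strategy → Target d₀ → ℕ → Set
    Reaches X t i = u X i ≡ ray t × dist t ≤ x X i

    FirstReaches : Strategy → Target d₀ → ℕ → Set
    FirstReaches X t i = Reaches X t i × (∀ j → j ℕ.< i → ¬ Reaches X t j)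

    d : Strategy → Target d₀ → ℝ∞
    d X t = walked em
      where
      walked : Dec (∃[ i ] FirstReaches X t i) → ℝ∞
      walked (yes (i , _)) = [ dist t + fromℕ 2 * ∑< i (x X) ]
      walked (no _)        = ⊤⁺

    ratio : Strategy → Target d₀ → ℝ∞
    ratio X t = map (_/ dist t) (d X t)

  Advice : ℕ → Set
  Advice k = Vec Bool k

  record AdviceStrategy (d₀ : ℝ) (k : ℕ) : Set where
    field
      A : Target d₀ → Advice k
      X : Advice k → Strategy

  module _ {d₀ : ℝ} {k : ℕ} (S : AdviceStrategy d₀ k) where
    open AdviceStrategy S

    private
      someTarget : Target d₀
      someTarget = target Fin.zero d₀ (IsTotalOrder.refl isTotalOrder)

      someAdvice : Advice k
      someAdvice = replicate k false

    consistency : ℝ∞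
    consistency = sup someTarget λ t → ratio (X (A t)) t

    robustness : ℝ∞
    robustness = sup someTarget λ t → sup someAdvice λ h → ratio (X h) t

    IsRobust : ℝ → Set
    IsRobust r = robustness ≤⁺ [ r ]

  ρ : ℝ → ℝ
  ρ r = (r - 1#) / fromℕ 2

  -- The equation is only meaningful where its denominator is nonzero.
  IsRoot : ℝ → Pred ℝ 0ℓ
  IsRoot r x = x ≢ 1# × x ^ʳ 2 / (x - 1#) - ρ r ≡ 0#

  -- IsLargestRoot r b says that b is b_r.
  IsLargestRoot : ℝ → Pred ℝ 0ℓ
  IsLargestRoot r = IsGreatest _≤_ (IsRoot r)

  -- IsPositiveRoot q b β says that β is b to the power 1/q.
  IsPositiveRoot : ℕ → ℝ → Pred ℝ 0ℓ
  IsPositiveRoot q b β = 0# < β × β ^ʳ q ≡ b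

{-# OPTIONS --safe #-}
module Submission where

-- Let a = b - 1 and suppose the consistency is at most 1 + 2γ with γ a < β = b^(1/q). An iteration whose preceding
-- turning distances add up to T serves, with ratio at most 1 + 2γ, only targets on its own ray at distances between
-- T / γ and its turning point. Group the iterations of a robust strategy into phases, a new phase beginning when new
-- ground is first explored on the other ray. If T_j is the sum before phase j, which reaches distance z_j, then
-- T_j + z_j ≤ T_{j+1} and, by robustness, T_{j+2} ≤ ρ z_j. The recurrence T_{j+2} ≤ ρ (T_{j+1} - T_j) has the
-- characteristic roots b and b′ = b / (b - 1) ≤ b, so eventually T_{j+1} ≤ (b + ε) T_j, and the served interval
-- [T_j / γ, z_j] has ratio L with L^q < T_{j+1} / T_j by a fixed factor: L^q T_j / T_{j+1} is largest for
-- T_{j+1} ≈ b T_j, where L ≈ γ a < β. Hence, on a logarithmic scale, the 2q strategies each serve less than a share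
-- 1/q of one ray, too little to serve both rays jointly. Logarithmic length is replaced by counting points of a
-- geometric grid κ^m A with κ close to 1.

open import Level using (0ℓ)
open import Axiom.ExcludedMiddle using (ExcludedMiddle)
open import Algebra.Bundles using (CommutativeRing)
import Algebra.Properties.CommutativeSemiring.Exp as CommutativeExpProperties
import Algebra.Properties.Ring as RingProperties
import Algebra.Properties.Semiring.Exp as ExpProperties
import Algebra.Solver.Ring.NaturalCoefficients.Default as NaturalSolver
open import Data.Bool.Base using (Bool; true; false)
open import Data.Empty using (⊥)
open import Data.Fin.Base using (Fin; zero; suc; opposite)
open import Data.Fin.Properties using (opposite-involutive; _≟_)
open import Data.Nat.Base as ℕ using (ℕ; zero; suc; s≤s; z≤n)
open import Data.Nat.Induction using (<-rec)
import Data.Nat.Properties as ℕ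
open import Data.Nat.Solver using (module +-*-Solver)
open import Data.Product.Base using (_×_; _,_; ∃; ∃-syntax; proj₁; proj₂)
open import Data.Sum.Base using (_⊎_; inj₁; inj₂)
open import Data.Unit.Base using (⊤)
open import Data.Vec.Base using (Vec; []; _∷_; head; tail)
open import Function.Base using (_∘_)
open import Relation.Binary.Bundles using (TotalOrder)
import Relation.Binary.Construct.Add.Supremum.NonStrict as AddTop
import Relation.Binary.Construct.NonStrictToStrict as ToStrict
open import Relation.Binary.PropositionalEquality using
  (_≡_; _≢_; refl; sym; trans; cong; cong₂; subst; subst₂; ≢-sym)
import Relation.Binary.Reasoning.PartialOrder as PosetReasoning
open import Relation.Nullary using (¬_; Dec; yes; no; contradiction)
open import Relation.Nullary.Construct.Add.Supremum using (⊤⁺; [_])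
open import Defs

-- Ordered-field arithmetic: powers, the Archimedean property, approximate roots.

module OrderedField (em : ExcludedMiddle 0ℓ) (R : CompleteOrderedField) where
  open Search em R public
  open CommutativeRing commutativeRing public
    using (+-comm; +-identityˡ; +-identityʳ; *-comm; *-assoc; *-identityˡ; *-identityʳ;
           -‿inverseʳ; -‿inverseˡ; zeroʳ; distribˡ; +-assoc; commutativeSemiring; ring)
  open RingProperties ring public using (-‿distribʳ-*; -‿distribˡ-*; -‿involutive)
  open ExpProperties semiring public using (^-homo-*; ^-assocʳ)
  open NaturalSolver commutativeSemiring public using (solve; con; _:+_; _:*_; _:=_)

  totalOrder : TotalOrder 0ℓ 0ℓ 0ℓ
  totalOrder = record { isTotalOrder = isTotalOrder }

  open TotalOrder totalOrder public
    using () renaming (refl to ≤-refl; reflexive to ≤-reflexive; trans to ≤-trans;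
                       total to ≤-total; antisym to ≤-antisym)

  module ≤-Reasoning = PosetReasoning (TotalOrder.poset totalOrder)
  open ≤-Reasoning

  ≰⇒> : ∀ {x y} → ¬ (x ≤ y) → y < x
  ≰⇒> = ToStrict.≰⇒> _≡_ _≤_ sym ≤-reflexive ≤-total

  <⇒≱ : ∀ {x y} → x < y → ¬ (y ≤ x)
  <⇒≱ = ToStrict.<⇒≱ _≡_ _≤_ ≤-antisym

  ≮⇒≥ : ∀ {x y} → ¬ (x < y) → y ≤ x
  ≮⇒≥ = ToStrict.≮⇒≥ _≡_ _≤_ sym (λ _ _ → em) ≤-reflexive ≤-total

  <-≤-trans : ∀ {x y z} → x < y → y ≤ z → x < z
  <-≤-trans = ToStrict.<-≤-trans _≡_ _≤_ sym ≤-trans ≤-antisym (λ { refl p → p })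

  ≤-<-trans : ∀ {x y z} → x ≤ y → y < z → x < z
  ≤-<-trans = ToStrict.≤-<-trans _≡_ _≤_ ≤-trans ≤-antisym (λ { refl p → p })

  +-monoʳ-≤ : ∀ z {x y} → x ≤ y → z + x ≤ z + y
  +-monoʳ-≤ z {x} {y} p = subst₂ _≤_ (+-comm x z) (+-comm y z) (+-mono-≤ z p)

  cancelʳ : ∀ x z → x + z + - z ≡ x
  cancelʳ x z = trans (+-assoc x z (- z)) (trans (cong (x +_) (-‿inverseʳ z)) (+-identityʳ x))

  +-cancelʳ-≤ : ∀ z {x y} → x + z ≤ y + z → x ≤ y
  +-cancelʳ-≤ z {x} {y} p = subst₂ _≤_ (cancelʳ x z) (cancelʳ y z) (+-mono-≤ (- z) p)

  +-cancelˡ-≤ : ∀ z {x y} → z + x ≤ z + y → x ≤ y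
  +-cancelˡ-≤ z {x} {y} p = +-cancelʳ-≤ z (subst₂ _≤_ (+-comm z x) (+-comm z y) p)

  +-monoʳ-< : ∀ z {x y} → x < y → z + x < z + y
  +-monoʳ-< z p = ≰⇒> (<⇒≱ p ∘ +-cancelˡ-≤ z)

  x-y+y : ∀ x y → x - y + y ≡ x
  x-y+y x y = trans (+-assoc x (- y) y) (trans (cong (x +_) (-‿inverseˡ y)) (+-identityʳ x))

  0≤y-x : ∀ {x y} → x ≤ y → 0# ≤ y - x
  0≤y-x {x} p = subst (_≤ _) (-‿inverseʳ x) (+-mono-≤ (- x) p)

  x≤x+y : ∀ x {y} → 0# ≤ y → x ≤ x + y
  x≤x+y x {y} p = subst (_≤ x + y) (+-identityʳ x) (+-monoʳ-≤ x p)

  x<x+y : ∀ x {y} → 0# < y → x < x + y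
  x<x+y x {y} p = subst (_< x + y) (+-identityʳ x) (+-monoʳ-< x p)

  *-monoʳ-≤ : ∀ z {x y} → 0# ≤ z → x ≤ y → z * x ≤ z * y
  *-monoʳ-≤ z {x} {y} 0≤z x≤y = begin
    z * x                    ≤⟨ x≤x+y (z * x) (*-nonneg 0≤z (0≤y-x x≤y)) ⟩
    z * x + z * (y - x)      ≡⟨ distribˡ z x (y - x) ⟨
    z * (x + (y - x))        ≡⟨ cong (z *_) (trans (+-comm x (y - x)) (x-y+y y x)) ⟩
    z * y                    ∎

  *-monoˡ-≤ : ∀ z {x y} → 0# ≤ z → x ≤ y → x * z ≤ y * z
  *-monoˡ-≤ z {x} {y} 0≤z x≤y = subst₂ _≤_ (*-comm z x) (*-comm z y) (*-monoʳ-≤ z 0≤z x≤y)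

  *-mono-≤ : ∀ {x y u v} → 0# ≤ u → 0# ≤ y → x ≤ y → u ≤ v → x * u ≤ y * v
  *-mono-≤ {y = y} {u} 0≤u 0≤y x≤y u≤v = ≤-trans (*-monoˡ-≤ u 0≤u x≤y) (*-monoʳ-≤ y 0≤y u≤v)

  0≤x² : ∀ x → 0# ≤ x * x
  0≤x² x with ≤-total 0# x
  ... | inj₁ 0≤x = *-nonneg 0≤x 0≤x
  ... | inj₂ x≤0 = subst (0# ≤_) eq (*-nonneg 0≤-x 0≤-x)
    where
    0≤-x : 0# ≤ - x
    0≤-x = subst₂ _≤_ (-‿inverseʳ x) (+-identityˡ (- x)) (+-mono-≤ (- x) x≤0)
    eq : - x * - x ≡ x * x
    eq = trans (sym (-‿distribˡ-* x (- x))) (trans (cong -_ (sym (-‿distribʳ-* x x))) (-‿involutive (x * x)))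

  0≤1 : 0# ≤ 1#
  0≤1 = subst (0# ≤_) (*-identityˡ 1#) (0≤x² 1#)

  0<1 : 0# < 1#
  0<1 = 0≤1 , 0≢1

  ⁻¹-inverseˡ : ∀ {x} → 0# < x → x ⁻¹ * x ≡ 1#
  ⁻¹-inverseˡ {x} 0<x = trans (*-comm (x ⁻¹) x) (⁻¹-inverse (≢-sym (proj₂ 0<x)))

  0<x⁻¹ : ∀ {x} → 0# < x → 0# < x ⁻¹
  0<x⁻¹ {x} 0<x = ≰⇒> λ x⁻¹≤0 → <⇒≱ 0<1 (begin
    1#        ≡⟨ ⁻¹-inverse (≢-sym (proj₂ 0<x)) ⟨
    x * x ⁻¹  ≤⟨ *-monoʳ-≤ x (proj₁ 0<x) x⁻¹≤0 ⟩
    x * 0#    ≡⟨ zeroʳ x ⟩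
    0#        ∎)

  x*[y/x] : ∀ {x} y → 0# < x → x * (y / x) ≡ y
  x*[y/x] {x} y 0<x = begin-equality
    x * (y * x ⁻¹)  ≡⟨ solve 3 (λ x y i → x :* (y :* i) := y :* (i :* x)) refl x y (x ⁻¹) ⟩
    y * (x ⁻¹ * x)  ≡⟨ cong (y *_) (⁻¹-inverseˡ 0<x) ⟩
    y * 1#          ≡⟨ *-identityʳ y ⟩
    y               ∎

  *-cancelˡ-≤ : ∀ z {x y} → 0# < z → z * x ≤ z * y → x ≤ y
  *-cancelˡ-≤ z {x} {y} 0<z p = subst₂ _≤_ (lem x) (lem y) (*-monoʳ-≤ (z ⁻¹) (proj₁ (0<x⁻¹ 0<z)) p)
    where
    lem : ∀ x → z ⁻¹ * (z * x) ≡ x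
    lem x = trans (sym (*-assoc (z ⁻¹) z x)) (trans (cong (_* x) (⁻¹-inverseˡ 0<z)) (*-identityˡ x))

  *-monoʳ-< : ∀ z {x y} → 0# < z → x < y → z * x < z * y
  *-monoʳ-< z 0<z p = ≰⇒> (<⇒≱ p ∘ *-cancelˡ-≤ z 0<z)

  *-pos : ∀ {x y} → 0# < x → 0# < y → 0# < x * y
  *-pos {x} 0<x 0<y = subst (_< _) (zeroʳ x) (*-monoʳ-< x 0<x 0<y)

  /-pos : ∀ {x y} → 0# < x → 0# < y → 0# < x / y
  /-pos 0<x 0<y = *-pos 0<x (0<x⁻¹ 0<y)

  *≤⇒≤/ : ∀ {x y z} → 0# < z → z * x ≤ y → x ≤ y / z
  *≤⇒≤/ {x} {y} {z} 0<z p = *-cancelˡ-≤ z 0<z (subst (z * x ≤_) (sym (x*[y/x] y 0<z)) p)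

  x-y≡0⇒x≡y : ∀ {x y} → x - y ≡ 0# → x ≡ y
  x-y≡0⇒x≡y {x} {y} eq = trans (sym (x-y+y x y)) (trans (cong (_+ y) eq) (+-identityˡ y))

  x/y*y : ∀ x {y} → y ≢ 0# → x / y * y ≡ x
  x/y*y x {y} y≢0 = trans (*-assoc x (y ⁻¹) y)
    (trans (cong (x *_) (trans (*-comm (y ⁻¹) y) (⁻¹-inverse y≢0))) (*-identityʳ x))

  x*y/y : ∀ x {y} → y ≢ 0# → x * y / y ≡ x
  x*y/y x {y} y≢0 = trans (*-assoc x y (y ⁻¹)) (trans (cong (x *_) (⁻¹-inverse y≢0)) (*-identityʳ x))

  0<y-x : ∀ {x y} → x < y → 0# < y - x
  0<y-x (x≤y , x≢y) = 0≤y-x x≤y , λ 0≡y-x → x≢y (sym (x-y≡0⇒x≡y (sym 0≡y-x)))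

  *-cancelˡ-≡ : ∀ z {x y} → 0# < z → z * x ≡ z * y → x ≡ y
  *-cancelˡ-≡ z 0<z eq = ≤-antisym (*-cancelˡ-≤ z 0<z (≤-reflexive eq)) (*-cancelˡ-≤ z 0<z (≤-reflexive (sym eq)))

  2# : ℝ
  2# = fromℕ 2

  0<2 : 0# < 2#
  0<2 = <-≤-trans 0<1 (x≤x+y 1# (subst (0# ≤_) (sym (+-identityʳ 1#)) 0≤1))

  x≡1+2[x-1]/2 : ∀ x → x ≡ 1# + 2# * ((x - 1#) / 2#)
  x≡1+2[x-1]/2 x = sym (trans (cong (1# +_) (x*[y/x] (x - 1#) 0<2)) (trans (+-comm 1# (x - 1#)) (x-y+y x 1#)))

  dense : ∀ {x y} → x < y → ∃[ m ] (x < m × m < y)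
  dense {x} {y} x<y = m , ≰⇒> (λ m≤x → <⇒≱ x<y (+-cancelˡ-≤ x (begin
      x + y  ≡⟨ x*[y/x] (x + y) 0<2 ⟨
      2# * m ≤⟨ *-monoʳ-≤ 2# (proj₁ 0<2) m≤x ⟩
      2# * x ≡⟨ double x ⟩
      x + x  ∎))) ,
    ≰⇒> λ y≤m → <⇒≱ x<y (+-cancelʳ-≤ y (begin
      y + y  ≡⟨ double y ⟨
      2# * y ≤⟨ *-monoʳ-≤ 2# (proj₁ 0<2) y≤m ⟩
      2# * m ≡⟨ x*[y/x] (x + y) 0<2 ⟩
      x + y  ∎))
    where
    m = (x + y) / 2#
    double : ∀ x → 2# * x ≡ x + x
    double = solve 1 (λ x → (con 1 :+ (con 1 :+ con 0)) :* x := x :+ x) refl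

  ^-nonneg : ∀ {x} n → 0# ≤ x → 0# ≤ x ^ʳ n
  ^-nonneg zero    0≤x = 0≤1
  ^-nonneg (suc n) 0≤x = *-nonneg 0≤x (^-nonneg n 0≤x)

  ^-pos : ∀ {x} n → 0# < x → 0# < x ^ʳ n
  ^-pos zero    0<x = 0<1
  ^-pos (suc n) 0<x = *-pos 0<x (^-pos n 0<x)

  ^-monoˡ-≤ : ∀ {x y} n → 0# ≤ x → x ≤ y → x ^ʳ n ≤ y ^ʳ n
  ^-monoˡ-≤ zero    0≤x x≤y = ≤-refl
  ^-monoˡ-≤ (suc n) 0≤x x≤y = *-mono-≤ (^-nonneg n 0≤x) (≤-trans 0≤x x≤y) x≤y (^-monoˡ-≤ n 0≤x x≤y)

  1≤^ : ∀ {x} n → 1# ≤ x → 1# ≤ x ^ʳ n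
  1≤^ zero    1≤x = ≤-refl
  1≤^ {x} (suc n) 1≤x = subst (_≤ x * x ^ʳ n) (*-identityˡ 1#) (*-mono-≤ 0≤1 (≤-trans 0≤1 1≤x) 1≤x (1≤^ n 1≤x))

  ^-suc-< : ∀ {x} n → 1# < x → x ^ʳ n < x ^ʳ suc n
  ^-suc-< {x} n 1<x = subst₂ _<_ (*-identityʳ (x ^ʳ n)) (*-comm (x ^ʳ n) x)
    (*-monoʳ-< (x ^ʳ n) (^-pos n (<-≤-trans 0<1 (proj₁ 1<x))) 1<x)

  ^-mono-< : ∀ {x m n} → 1# < x → m ℕ.< n → x ^ʳ m < x ^ʳ n
  ^-mono-< {x} {m} 1<x m<n = go (ℕ.≤⇒≤′ m<n)
    where
    go : ∀ {n} → suc m ℕ.≤′ n → x ^ʳ m < x ^ʳ n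
    go ℕ.≤′-refl     = ^-suc-< m 1<x
    go (ℕ.≤′-step {n} p) = <-≤-trans (go p) (proj₁ (^-suc-< n 1<x))

  ^-monoʳ-≤ : ∀ {x m n} → 1# < x → m ℕ.≤ n → x ^ʳ m ≤ x ^ʳ n
  ^-monoʳ-≤ {x} {m} {n} 1<x m≤n with ℕ.m≤n⇒m<n∨m≡n m≤n
  ... | inj₁ m<n  = proj₁ (^-mono-< {x} {m} {n} 1<x m<n)
  ... | inj₂ refl = ≤-refl

  ^-cancel-≤ : ∀ {x m n} → 1# < x → x ^ʳ m ≤ x ^ʳ n → m ℕ.≤ n
  ^-cancel-≤ {x} {m} {n} 1<x p = ℕ.≮⇒≥ λ n<m → <⇒≱ (^-mono-< {x} {n} {m} 1<x n<m) p

  -- If the powers of `x` were bounded, their supremum `s` would satisfy `x ^ʳ n ≤ s / x` for all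
  -- `n`, because `x ^ʳ suc n ≤ s`; but `s / x < s`.
  ^-unbounded : ∀ {x} → 1# < x → ∀ y → ∃[ n ] y ≤ x ^ʳ n
  ^-unbounded {x} 1<x y with em {P = ∃[ n ] y ≤ x ^ʳ n}
  ... | yes p = p
  ... | no ¬p = contradiction (least λ { (n , refl) → *≤⇒≤/ 0<x (upper (suc n , refl)) }) (<⇒≱ s/x<s)
    where
    0<x = <-≤-trans 0<1 (proj₁ 1<x)
    Power : ℝ → Set
    Power z = ∃[ n ] x ^ʳ n ≡ z
    lub = complete Power (1# , 0 , refl) (y , λ { (n , refl) → proj₁ (≰⇒> λ q → ¬p (n , q)) })
    s = proj₁ lub
    upper = proj₁ (proj₂ lub)
    least = proj₂ (proj₂ lub)
    s/x<s : s / x < s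
    s/x<s = ≰⇒> λ s≤s/x → <⇒≱ 1<x (*-cancelˡ-≤ s (<-≤-trans 0<1 (upper (0 , refl))) (begin
      s * x       ≡⟨ *-comm s x ⟩
      x * s       ≤⟨ *-monoʳ-≤ x (proj₁ 0<x) s≤s/x ⟩
      x * (s / x) ≡⟨ x*[y/x] s 0<x ⟩
      s           ≡⟨ *-identityʳ s ⟨
      s * 1#      ∎))

  -- y = 2x / (1 + x), the harmonic mean of 1 and x
  square-below : ∀ {x} → 1# < x → ∃[ y ] (1# < y × y * y ≤ x)
  square-below {x} 1<x = y , 1<y , y²≤x
    where
    0<x = <-≤-trans 0<1 (proj₁ 1<x)
    s = 1# + x
    0<s : 0# < s
    0<s = <-≤-trans 0<1 (x≤x+y 1# (proj₁ 0<x))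
    y = (x + x) / s
    sy : s * y ≡ x + x
    sy = x*[y/x] (x + x) 0<s
    1<y : 1# < y
    1<y = ≰⇒> λ y≤1 → <⇒≱ 1<x (+-cancelʳ-≤ x (begin
      x + x   ≡⟨ sy ⟨
      s * y   ≤⟨ *-monoʳ-≤ s (proj₁ 0<s) y≤1 ⟩
      s * 1#  ≡⟨ *-identityʳ s ⟩
      1# + x  ∎))
    -- With `x` written as `1# + e`, the identity 4x² + x(x - 1)² = (1 + x)²x is free of
    -- subtraction, as the semiring solver requires.
    e = x - 1#
    x≡1+e : x ≡ 1# + e
    x≡1+e = sym (trans (+-comm 1# e) (x-y+y x 1#))
    y²≤x : y * y ≤ x
    y²≤x = *-cancelˡ-≤ (s * s) (*-pos 0<s 0<s) (begin
      s * s * (y * y)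
        ≡⟨ solve 2 (λ s y → s :* s :* (y :* y) := (s :* y) :* (s :* y)) refl s y ⟩
      (s * y) * (s * y)
        ≡⟨ cong₂ _*_ sy sy ⟩
      (x + x) * (x + x)
        ≤⟨ x≤x+y _ (*-nonneg (proj₁ 0<x) (0≤x² e)) ⟩
      (x + x) * (x + x) + x * (e * e)
        ≡⟨ subst (λ x → (x + x) * (x + x) + x * (e * e) ≡ (1# + x) * (1# + x) * x) (sym x≡1+e)
             (solve 1 (λ e → let x = con 1 :+ e in
               (x :+ x) :* (x :+ x) :+ x :* (e :* e) := (con 1 :+ x) :* (con 1 :+ x) :* x) refl e) ⟩
      s * s * x ∎)

  -- The smaller of `v` and `w` works, where `v * v ≤ x` and `w ^ʳ n ≤ v`: one factor is at most
  -- `v`, and so is the product of the other `n`.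
  root-below : ∀ n {x} → 1# < x → ∃[ y ] (1# < y × y ^ʳ n ≤ x)
  root-below zero    {x} 1<x = x , 1<x , proj₁ 1<x
  root-below (suc n) {x} 1<x =
    let v , 1<v , v²≤x = square-below 1<x
        w , 1<w , wⁿ≤v = root-below n 1<v
    in smaller 1<v v²≤x 1<w wⁿ≤v (≤-total v w)
    where
    smaller : ∀ {v w} → 1# < v → v * v ≤ x → 1# < w → w ^ʳ n ≤ v → v ≤ w ⊎ w ≤ v →
              ∃[ y ] (1# < y × y * y ^ʳ n ≤ x)
    smaller {v} {w} 1<v v²≤x 1<w wⁿ≤v (inj₁ v≤w) = v , 1<v ,
      ≤-trans (*-monoʳ-≤ v 0≤v (≤-trans (^-monoˡ-≤ n 0≤v v≤w) wⁿ≤v)) v²≤x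
      where 0≤v = ≤-trans 0≤1 (proj₁ 1<v)
    smaller {v} {w} 1<v v²≤x 1<w wⁿ≤v (inj₂ w≤v) = w , 1<w ,
      ≤-trans (*-mono-≤ (^-nonneg n (≤-trans 0≤1 (proj₁ 1<w))) (≤-trans 0≤1 (proj₁ 1<v)) w≤v wⁿ≤v) v²≤x

-- Discrete search and the two rays.

abstract
  least : ExcludedMiddle 0ℓ → (P : ℕ → Set) → ∃ P → ∃[ n ] (P n × (∀ j → j ℕ.< n → ¬ P j))
  least em P (n , p) = <-rec (λ n → P n → ∃[ n ] (P n × (∀ j → j ℕ.< n → ¬ P j))) step n p
    where
    step : ∀ n → (∀ {m} → m ℕ.< n → P m → ∃[ n ] (P n × (∀ j → j ℕ.< n → ¬ P j))) →
           P n → ∃[ n ] (P n × (∀ j → j ℕ.< n → ¬ P j))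
    step n rec p with em {P = ∃[ j ] (j ℕ.< n × P j)}
    ... | yes (j , j<n , q) = rec j<n q
    ... | no none           = n , p , λ j j<n q → none (j , j<n , q)

-- Locates the phase that contains a given iteration, and a phase at which the sums `T` cross a
-- limit.
last-before-change : ExcludedMiddle 0ℓ → (P : ℕ → Set) → P 0 → ∀ n → ¬ P n → ∃[ j ] (P j × ¬ P (suc j))
last-before-change em P p zero    ¬p = contradiction p ¬p
last-before-change em P p (suc n) ¬p with em {P = P n}
... | yes q = n , q , ¬p
... | no ¬q = last-before-change em P p n ¬q

≢⇒≡opposite : ∀ {e f : Fin 2} → e ≢ f → e ≡ opposite f
≢⇒≡opposite {zero}     {zero}     e≢f = contradiction refl e≢f
≢⇒≡opposite {zero}     {suc zero} e≢f = refl
≢⇒≡opposite {suc zero} {zero}     e≢f = refl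
≢⇒≡opposite {suc zero} {suc zero} e≢f = contradiction refl e≢f

≢opposite : ∀ (e : Fin 2) → e ≢ opposite e
≢opposite zero       ()
≢opposite (suc zero) ()

-- Decomposition of a robust strategy into phases.

module Phases (em : ExcludedMiddle 0ℓ) (R : CompleteOrderedField) where
  open OrderedField em R
  open Strategy

  ∑<-suc : ∀ n f → ∑< (suc n) f ≡ ∑< n f + f n
  ∑<-suc zero    f = +-comm (f 0) 0#
  ∑<-suc (suc n) f = trans (cong (f 0 +_) (∑<-suc n (f ∘ suc))) (sym (+-assoc (f 0) (∑< n (f ∘ suc)) (f (suc n))))

  steps-mono : ∀ (f : ℕ → ℝ) → (∀ n → f n ≤ f (suc n)) → ∀ {m n} → m ℕ.≤ n → f m ≤ f n
  steps-mono f step m≤n = go (ℕ.≤⇒≤′ m≤n)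
    where
    go : ∀ {m n} → m ℕ.≤′ n → f m ≤ f n
    go ℕ.≤′-refl     = ≤-refl
    go (ℕ.≤′-step p) = ≤-trans (go p) (step _)

  -- With `s` equal to `γ` times the distance of `t` this expresses a ratio of at most 1 + 2γ, free
  -- of division and of infinite values.
  Finds : ∀ {d₀} → Strategy → Target d₀ → ℝ → Set
  Finds X t s = ∃[ n ] (FirstReaches X t n × ∑< n (x X) ≤ s)

  -- Phase j explores ray e j up to distance z j, and T j is the sum of the turning distances before it.
  record PhaseSequence {d₀ : ℝ} (ρ : ℝ) (X : Strategy) : Set where
    field
      T z     : ℕ → ℝ
      e       : ℕ → Fin 2
      T-pos   : 0# < T 0
      z-pos   : ∀ j → 0# < z j
      T+z≤    : ∀ j → T j + z j ≤ T (suc j)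
      T≤ρz    : ∀ j → T (suc (suc j)) ≤ ρ * z j
      cover   : (t : Target d₀) → ∀ n → FirstReaches X t n → T 0 < Target.dist t → d₀ < Target.dist t →
                ∃[ j ] (e j ≡ Target.ray t × T j ≤ ∑< n (x X) × Target.dist t ≤ z j)

  module Construction {d₀ ρ : ℝ} (0<d₀ : 0# < d₀) (0<ρ : 0# < ρ) (X : Strategy)
                      (finds : (t : Target d₀) → Finds X t (ρ * Target.dist t)) where
    S : ℕ → ℝ
    S n = ∑< n (x X)

    S-suc : ∀ n → S (suc n) ≡ S n + x X n
    S-suc n = ∑<-suc n (x X)

    S-step : ∀ n → S n ≤ S (suc n)
    S-step n = subst (S n ≤_) (sym (S-suc n)) (x≤x+y (S n) (proj₁ (x-pos X n)))

    S-mono : ∀ {m n} → m ℕ.≤ n → S m ≤ S n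
    S-mono = steps-mono S S-step

    x≤S : ∀ {i n} → i ℕ.< n → x X i ≤ S n
    x≤S {i} {n} i<n = begin
      x X i         ≡⟨ +-identityˡ (x X i) ⟨
      0# + x X i    ≤⟨ +-mono-≤ (x X i) (S-mono {0} {i} z≤n) ⟩
      S i + x X i   ≡⟨ S-suc i ⟨
      S (suc i)     ≤⟨ S-mono i<n ⟩
      S n           ∎
      where open ≤-Reasoning

    -- The distance explored on ray `e` before iteration `n` starts at `d₀`, below which there are
    -- no targets. The recursion is mutual because the test for a record, an iteration that explores
    -- new ground, compares with the extent so far.
    extent : Fin 2 → ℕ → ℝ
    Record : Fin 2 → ℕ → Set
    extend : ∀ {e n} → Dec (Record e n) → ℝ

    extent e zero    = d₀
    extent e (suc n) = extend {e} {n} em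
    Record e n = u X n ≡ e × extent e n < x X n
    extend {e} {n} (yes _) = x X n
    extend {e} {n} (no _)  = extent e n

    extent-step : ∀ e n → extent e n ≤ extent e (suc n)
    extent-step e n with em {P = Record e n}
    ... | yes (_ , p) = proj₁ p
    ... | no _        = ≤-refl

    extent-mono : ∀ e {m n} → m ℕ.≤ n → extent e m ≤ extent e n
    extent-mono e = steps-mono (extent e) (extent-step e)

    0<extent : ∀ e n → 0# < extent e n
    0<extent e n = <-≤-trans 0<d₀ (extent-mono e {0} {n} z≤n)

    x≤extent : ∀ n → x X n ≤ extent (u X n) (suc n)
    x≤extent n with em {P = Record (u X n) n}
    ... | yes _ = ≤-refl
    ... | no ¬p = ≮⇒≥ λ q → ¬p (refl , q)

    extent-stay : ∀ {e n} → ¬ Record e n → extent e (suc n) ≡ extent e n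
    extent-stay {e} {n} ¬p with em {P = Record e n}
    ... | yes p = contradiction p ¬p
    ... | no _  = refl

    extent-record : ∀ {e n} → Record e n → extent e (suc n) ≡ x X n
    extent-record {e} {n} p with em {P = Record e n}
    ... | yes _ = refl
    ... | no ¬p = contradiction p ¬p

    extent-const : ∀ {e m n} → m ℕ.≤ n → (∀ j → m ℕ.≤ j → j ℕ.< n → ¬ Record e j) → extent e n ≡ extent e m
    extent-const {e} {m} m≤n = go (ℕ.≤⇒≤′ m≤n)
      where
      go : ∀ {n} → m ℕ.≤′ n → (∀ j → m ℕ.≤ j → j ℕ.< n → ¬ Record e j) → extent e n ≡ extent e m
      go ℕ.≤′-refl         _    = refl
      go (ℕ.≤′-step {n} p) none = trans (extent-stay (none n (ℕ.≤′⇒≤ p) ℕ.≤-refl))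
                                        (go p λ j m≤j j<n → none j m≤j (ℕ.m<n⇒m<1+n j<n))

    extent≤x-or-d₀ : ∀ e n → extent e n ≡ d₀ ⊎ ∃[ j ] (j ℕ.< n × u X j ≡ e × extent e n ≡ x X j)
    extent≤x-or-d₀ e zero    = inj₁ refl
    extent≤x-or-d₀ e (suc n) with em {P = Record e n}
    ... | yes (eq , _) = inj₂ (n , ℕ.≤-refl , eq , refl)
    ... | no _ with extent≤x-or-d₀ e n
    ...   | inj₁ p                 = inj₁ p
    ...   | inj₂ (j , j<n , eq , p) = inj₂ (j , ℕ.m<n⇒m<1+n j<n , eq , p)

    unreached : ∀ (t : Target d₀) {n j} → extent (Target.ray t) n < Target.dist t → j ℕ.< n → ¬ Reaches X t j
    unreached (target _ dist _) {n} {j} p j<n (refl , dist≤x) = <⇒≱ p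
      (≤-trans dist≤x (≤-trans (x≤extent j) (extent-mono (u X j) j<n)))

    -- By `extent≤x-or-d₀` the extent is `d₀` or an earlier turning point on the ray of `t`, and a
    -- target not reached before lies strictly beyond either. A target at `d₀` itself need not
    -- extend anything, hence the strict hypothesis.
    firstReach⇒record : ∀ (t : Target d₀) {n} → d₀ < Target.dist t → FirstReaches X t n → Record (Target.ray t) n
    firstReach⇒record (target e dist _) {n} d₀<dist ((eq , dist≤x) , first) = eq , <-≤-trans extent<dist dist≤x
      where
      extent<dist : extent e n < dist
      extent<dist with extent≤x-or-d₀ e n
      ... | inj₁ p                  = subst (_< dist) (sym p) d₀<dist
      ... | inj₂ (j , j<n , eq′ , p) = subst (_< dist) (sym p) (≰⇒> λ q → first j j<n (eq′ , q))

    firstReach-unique : ∀ (t : Target d₀) {m n} → FirstReaches X t m → FirstReaches X t n → m ≡ n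
    firstReach-unique t {m} {n} (p , p-first) (q , q-first) =
      ℕ.≤-antisym (ℕ.≮⇒≥ λ n<m → p-first n n<m q) (ℕ.≮⇒≥ λ m<n → q-first m m<n p)

    -- The targets just beyond the extent are first reached in the record iteration.
    record⇒S≤ρextent : ∀ {e n} → Record e n → S n ≤ ρ * extent e n
    record⇒S≤ρextent {e} {n} (eq , extent<x) = ≮⇒≥ late
      where
      M = extent e n
      late : ¬ (ρ * M < S n)
      late lt = <⇒≱ ρm<S S≤ρm
        where
        -- A target at distance `m`, above `M` but below both the turning point and `S n / ρ`, is
        -- first reached in iteration `n` and costs too much.
        between : ∃[ m ] (M < m × m ≤ x X n × ρ * m < S n)
        between = choose (≤-total (x X n) (S n / ρ))
          where
          choose : x X n ≤ S n / ρ ⊎ S n / ρ ≤ x X n → ∃[ m ] (M < m × m ≤ x X n × ρ * m < S n)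
          choose (inj₁ x≤S/ρ) = let m , M<m , m<x = dense extent<x in
            m , M<m , proj₁ m<x , subst (ρ * m <_) (x*[y/x] (S n) 0<ρ) (*-monoʳ-< ρ 0<ρ (<-≤-trans m<x x≤S/ρ))
          choose (inj₂ S/ρ≤x) = let m , M<m , m<S/ρ = dense {M} {S n / ρ} (≰⇒> λ q → <⇒≱ lt (/-≤⁻ q)) in
            m , M<m , ≤-trans (proj₁ m<S/ρ) S/ρ≤x , subst (ρ * m <_) (x*[y/x] (S n) 0<ρ) (*-monoʳ-< ρ 0<ρ m<S/ρ)
            where
            /-≤⁻ : S n / ρ ≤ M → S n ≤ ρ * M
            /-≤⁻ q = subst (_≤ ρ * M) (x*[y/x] (S n) 0<ρ) (*-monoʳ-≤ ρ (proj₁ 0<ρ) q)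
        m = proj₁ between
        M<m = proj₁ (proj₂ between)
        t : Target d₀
        t = target e m (≤-trans (extent-mono e {0} {n} z≤n) (proj₁ M<m))
        first : FirstReaches X t n
        first = (eq , proj₁ (proj₂ (proj₂ between))) , λ j j<n → unreached t M<m j<n
        S≤ρm : S n ≤ ρ * m
        S≤ρm = let i , p , q = finds t in subst (λ i → S i ≤ ρ * m) (firstReach-unique t p first) q
        ρm<S : ρ * m < S n
        ρm<S = proj₂ (proj₂ (proj₂ between))

    -- `extent e n` is the turning distance of the latest record on `e` before `n`. That iteration
    -- is `i` or later, so its distance is a summand of `S n` beyond those of `S i`.
    record-sum : ∀ {e i n} → Record e i → i ℕ.< n → S i + extent e n ≤ S n
    record-sum {e} {i} p i<n = go (ℕ.≤⇒≤′ i<n)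
      where
      go : ∀ {n} → suc i ℕ.≤′ n → S i + extent e n ≤ S n
      go ℕ.≤′-refl         = ≤-reflexive (trans (cong (S i +_) (extent-record p)) (sym (S-suc i)))
      go (ℕ.≤′-step {n} q) with em {P = Record e n}
      ... | yes _ = subst (S i + x X n ≤_) (sym (S-suc n))
                      (+-mono-≤ (x X n) (S-mono (ℕ.≤-trans (ℕ.n≤1+n i) (ℕ.≤′⇒≤ q))))
      ... | no _  = ≤-trans (go q) (S-step n)

    -- Robustness forces the target one unit beyond `extent e m` to be found, and no iteration
    -- before `m` reaches it.
    record-exists : ∀ e m → ∃[ n ] (m ℕ.≤ n × Record e n)
    record-exists e m = let n , first , _ = finds t in
      n , ℕ.≮⇒≥ (λ n<m → unreached t M<dist n<m (proj₁ first)) ,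
      firstReach⇒record t (<-≤-trans d₀<dist ≤-refl) first
      where
      M = extent e m
      M<dist : M < M + 1#
      M<dist = x<x+y M 0<1
      d₀<dist : d₀ < M + 1#
      d₀<dist = ≰⇒> λ q → <⇒≱ M<dist (≤-trans q (extent-mono e {0} {m} z≤n))
      t : Target d₀
      t = target e (M + 1#) (proj₁ d₀<dist)

    next : ∀ e m → ∃[ n ] ((m ℕ.≤ n × Record e n) × (∀ j → j ℕ.< n → ¬ (m ℕ.≤ j × Record e j)))
    next e m = least em _ (record-exists e m)

    ray : ℕ → Fin 2
    ray zero    = zero
    ray (suc j) = opposite (ray j)

    abstract
      start : ℕ → ℕ
      -- Starting at iteration 1 or later keeps `x X 0` in the sum before phase 0, so that `T 0` is
      -- positive.
      start zero    = proj₁ (next (ray 0) 1)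
      start (suc j) = proj₁ (next (ray (suc j)) (suc (start j)))

      start-record : ∀ j → Record (ray j) (start j)
      start-record zero    = proj₂ (proj₁ (proj₂ (next (ray 0) 1)))
      start-record (suc j) = proj₂ (proj₁ (proj₂ (next (ray (suc j)) (suc (start j)))))

      start-< : ∀ j → start j ℕ.< start (suc j)
      start-< j = proj₁ (proj₁ (proj₂ (next (ray (suc j)) (suc (start j)))))

      start-least : ∀ j {n} → start j ℕ.< n → n ℕ.< start (suc j) → ¬ Record (ray (suc j)) n
      start-least j s<n n<s p = proj₂ (proj₂ (next (ray (suc j)) (suc (start j)))) _ n<s (s<n , p)

      0<start : 0 ℕ.< start 0
      0<start = proj₁ (proj₁ (proj₂ (next (ray 0) 1)))

    j≤start : ∀ j → j ℕ.≤ start j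
    j≤start zero    = z≤n
    j≤start (suc j) = ℕ.≤-<-trans (j≤start j) (start-< j)

    sequence : PhaseSequence {d₀} ρ X
    sequence = record
      { T = S ∘ start
      ; z = reached
      ; e = ray
      ; T-pos = <-≤-trans (x-pos X 0) (x≤S 0<start)
      ; z-pos = λ j → 0<extent (ray j) (start (suc j))
      ; T+z≤ = λ j → record-sum (start-record j) (start-< j)
      ; T≤ρz = T≤ρz
      ; cover = cover
      }
      where
      reached : ℕ → ℝ
      reached j = extent (ray j) (start (suc j))

      -- Phase `j + 2` returns to the ray of phase `j`. Phase `j + 1` has no record on it: its first
      -- iteration walks on the other ray, and `start-least` excludes the later ones. At the return
      -- the extent is therefore still `reached j`, and `record⇒S≤ρextent` applies.
      T≤ρz : ∀ j → S (start (suc (suc j))) ≤ ρ * reached j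
      T≤ρz j = subst (λ M → S (start (suc (suc j))) ≤ ρ * M) eq (record⇒S≤ρextent rec)
        where
        rec : Record (ray j) (start (suc (suc j)))
        rec = subst (λ e → Record e (start (suc (suc j)))) (opposite-involutive (ray j)) (start-record (suc (suc j)))
        other : ¬ Record (ray j) (start (suc j))
        other p = ≢opposite (ray j) (trans (sym (proj₁ p)) (proj₁ (start-record (suc j))))
        eq : extent (ray j) (start (suc (suc j))) ≡ reached j
        eq = trans (extent-const (start-< (suc j)) λ n s<n n<s p → start-least (suc j) s<n n<s
                      (subst (λ e → Record e n) (sym (opposite-involutive (ray j))) p))
                   (extent-stay other)

      -- All records of phase `j` are on `ray j`, since the first one on the other ray opens the
      -- next phase; so the record that reaches `t` identifies the ray. Iterations before `start 0`
      -- turn at distance at most `T 0` and cannot reach `t`.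
      cover : (t : Target d₀) → ∀ n → FirstReaches X t n → S (start 0) < Target.dist t → d₀ < Target.dist t →
              ∃[ j ] (ray j ≡ Target.ray t × S (start j) ≤ S n × Target.dist t ≤ reached j)
      cover t n first T<dist d₀<dist =
        j , same-ray , S-mono start≤n , ≤-trans (proj₂ (proj₁ first)) (subst (λ e → x X n ≤ extent e (start (suc j)))
          (trans (proj₁ (proj₁ first)) (sym same-ray)) (≤-trans (x≤extent n) (extent-mono (u X n) n<start)))
        where
        start0≤n : start 0 ℕ.≤ n
        start0≤n = ℕ.≮⇒≥ λ n<s → <⇒≱ T<dist (≤-trans (proj₂ (proj₁ first)) (x≤S n<s))
        -- As `start` is strictly increasing, phase `suc n` starts after iteration `n`.
        crossing = last-before-change em (λ j → start j ℕ.≤ n) start0≤n (suc n) (ℕ.<⇒≱ (j≤start (suc n)))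
        j = proj₁ crossing
        start≤n = proj₁ (proj₂ crossing)
        n<start = ℕ.≰⇒> (proj₂ (proj₂ crossing))
        rec : Record (Target.ray t) n
        rec = firstReach⇒record t d₀<dist first
        same-ray : ray j ≡ Target.ray t
        same-ray with ray j ≟ Target.ray t
        ... | yes eq = eq
        ... | no neq = contradiction (subst (λ e → Record e n) other rec)
                         (start-least j (ℕ.≤∧≢⇒< start≤n start≢n) n<start)
          where
          other : Target.ray t ≡ opposite (ray j)
          other = ≢⇒≡opposite (≢-sym neq)
          start≢n : start j ≢ n
          start≢n eq = neq (trans (sym (proj₁ (start-record j))) (trans (cong (u X) eq) (proj₁ rec)))

-- Growth of the sums `T` under the linear recurrence.

module Growth (em : ExcludedMiddle 0ℓ) (R : CompleteOrderedField) where
  open OrderedField em R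
  open CommutativeExpProperties commutativeSemiring using (^-distrib-*)
  open ≤-Reasoning

  -- The characteristic roots of the recurrence are b and b′.
  module _ (T : ℕ → ℝ) (0<T : ∀ j → 0# < T j)
           {b b′ ε : ℝ} (0<b : 0# < b) (b′≤b : b′ ≤ b) (0<b′ : 0# < b′) (0<ε : 0# < ε)
           (recurrence : ∀ j → T (suc (suc j)) + b * b′ * T j ≤ (b + b′) * T (suc j)) where

    -- The recurrence reads `T₂ - b * T₁ ≤ b′ * (T₁ - b * T₀)`. If `b′ * T₀ ≤ T₁`, slowness bounds
    -- the right side by `ε * (b′ * T₀) ≤ ε * T₁`. Otherwise its form
    -- `T₂ - b′ * T₁ ≤ b * (T₁ - b′ * T₀)` gives even `T₂ ≤ b′ * T₁`.
    slow-suc : ∀ j → T (suc j) ≤ (b + ε) * T j → T (suc (suc j)) ≤ (b + ε) * T (suc j)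
    slow-suc j slow = cases (≤-total (b′ * T₀) T₁)
      where
      T₀ = T j
      T₁ = T (suc j)
      T₂ = T (suc (suc j))
      cases : b′ * T₀ ≤ T₁ ⊎ T₁ ≤ b′ * T₀ → T₂ ≤ (b + ε) * T₁
      cases (inj₁ p) = +-cancelʳ-≤ (b * b′ * T₀) (begin
        T₂ + b * b′ * T₀                          ≤⟨ recurrence j ⟩
        (b + b′) * T₁                             ≡⟨ solve 3 (λ b b′ T₁ → (b :+ b′) :* T₁ := b :* T₁ :+ b′ :* T₁) refl b b′ T₁ ⟩
        b * T₁ + b′ * T₁                          ≤⟨ +-monoʳ-≤ (b * T₁) (*-monoʳ-≤ b′ (proj₁ 0<b′) slow) ⟩
        b * T₁ + b′ * ((b + ε) * T₀)              ≡⟨ solve 5 (λ b b′ ε T₀ T₁ → b :* T₁ :+ b′ :* ((b :+ ε) :* T₀) :=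
                                                      ε :* (b′ :* T₀) :+ (b :* T₁ :+ b :* b′ :* T₀)) refl b b′ ε T₀ T₁ ⟩
        ε * (b′ * T₀) + (b * T₁ + b * b′ * T₀)    ≤⟨ +-mono-≤ _ (*-monoʳ-≤ ε (proj₁ 0<ε) p) ⟩
        ε * T₁ + (b * T₁ + b * b′ * T₀)           ≡⟨ solve 5 (λ b b′ ε T₀ T₁ → ε :* T₁ :+ (b :* T₁ :+ b :* b′ :* T₀) :=
                                                      (b :+ ε) :* T₁ :+ b :* b′ :* T₀) refl b b′ ε T₀ T₁ ⟩
        (b + ε) * T₁ + b * b′ * T₀                ∎)
      cases (inj₂ p) = ≤-trans (+-cancelʳ-≤ (b * b′ * T₀) (begin
        T₂ + b * b′ * T₀           ≤⟨ recurrence j ⟩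
        (b + b′) * T₁              ≡⟨ solve 3 (λ b b′ T₁ → (b :+ b′) :* T₁ := b′ :* T₁ :+ b :* T₁) refl b b′ T₁ ⟩
        b′ * T₁ + b * T₁           ≤⟨ +-monoʳ-≤ (b′ * T₁) (*-monoʳ-≤ b (proj₁ 0<b) p) ⟩
        b′ * T₁ + b * (b′ * T₀)    ≡⟨ cong (b′ * T₁ +_) (*-assoc b b′ T₀) ⟨
        b′ * T₁ + b * b′ * T₀      ∎))
        (*-monoˡ-≤ T₁ (proj₁ (0<T (suc j))) (≤-trans b′≤b (x≤x+y b (proj₁ 0<ε))))

    -- The recurrence multiplies `T (suc j) - b′ * T j` by at most `b` in each step.
    T≤b′T+bʲ : ∀ j → T (suc j) ≤ b′ * T j + b ^ʳ j * T 1
    T≤b′T+bʲ zero    = begin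
      T 1                  ≤⟨ x≤x+y (T 1) (*-nonneg (proj₁ 0<b′) (proj₁ (0<T 0))) ⟩
      T 1 + b′ * T 0       ≡⟨ solve 2 (λ x y → x :+ y := y :+ con 1 :* x) refl (T 1) (b′ * T 0) ⟩
      b′ * T 0 + 1# * T 1  ∎
    T≤b′T+bʲ (suc j) = +-cancelʳ-≤ (b * b′ * T j) (begin
      T (suc (suc j)) + b * b′ * T j
        ≤⟨ recurrence j ⟩
      (b + b′) * T (suc j)
        ≡⟨ solve 3 (λ b b′ T₁ → (b :+ b′) :* T₁ := b :* T₁ :+ b′ :* T₁) refl b b′ (T (suc j)) ⟩
      b * T (suc j) + b′ * T (suc j)
        ≤⟨ +-mono-≤ (b′ * T (suc j)) (*-monoʳ-≤ b (proj₁ 0<b) (T≤b′T+bʲ j)) ⟩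
      b * (b′ * T j + b ^ʳ j * T 1) + b′ * T (suc j)
        ≡⟨ solve 6 (λ b b′ T₀ p W T₁ → b :* (b′ :* T₀ :+ p :* W) :+ b′ :* T₁ :=
             b′ :* T₁ :+ b :* p :* W :+ b :* b′ :* T₀) refl b b′ (T j) (b ^ʳ j) (T 1) (T (suc j)) ⟩
      b′ * T (suc j) + b ^ʳ suc j * T 1 + b * b′ * T j ∎)

    fast⇒^≤T : (∀ j → (b + ε) * T j ≤ T (suc j)) → ∀ j → (b + ε) ^ʳ j * T 0 ≤ T j
    fast⇒^≤T fast zero    = ≤-reflexive (*-identityˡ (T 0))
    fast⇒^≤T fast (suc j) = begin
      (b + ε) * (b + ε) ^ʳ j * T 0   ≡⟨ *-assoc (b + ε) ((b + ε) ^ʳ j) (T 0) ⟩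
      (b + ε) * ((b + ε) ^ʳ j * T 0) ≤⟨ *-monoʳ-≤ (b + ε) (≤-trans (proj₁ 0<b) (x≤x+y b (proj₁ 0<ε))) (fast⇒^≤T fast j) ⟩
      (b + ε) * T j                  ≤⟨ fast j ⟩
      T (suc j)                      ∎

    -- Steady growth by `b + ε` gives `(b + ε) ^ʳ n * T 0 ≤ T n`, while `T≤b′T+bʲ` and `b′ ≤ b`
    -- leave `ε * T n ≤ b ^ʳ n * T 1`. The powers of `κ` would then be bounded by `K`.
    ¬always-fast : ¬ (∀ j → (b + ε) * T j < T (suc j))
    ¬always-fast fast = <⇒≱ (x<x+y K 0<1) (begin
        K + 1#    ≤⟨ K+1≤κⁿ ⟩
        κ ^ʳ n    ≤⟨ *≤⇒≤/ (*-pos 0<ε (0<T 0)) (*-cancelˡ-≤ (b ^ʳ n) (^-pos n 0<b) bound) ⟩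
        K         ∎)
      where
      κ = (b + ε) / b
      K = T 1 / (ε * T 0)
      bκ : b * κ ≡ b + ε
      bκ = x*[y/x] (b + ε) 0<b
      1<κ : 1# < κ
      1<κ = ≰⇒> λ κ≤1 → <⇒≱ (x<x+y b 0<ε) (subst₂ _≤_ bκ (*-identityʳ b) (*-monoʳ-≤ b (proj₁ 0<b) κ≤1))
      n = proj₁ (^-unbounded 1<κ (K + 1#))
      K+1≤κⁿ = proj₂ (^-unbounded 1<κ (K + 1#))
      εT≤ : ε * T n ≤ b ^ʳ n * T 1
      εT≤ = +-cancelˡ-≤ (b * T n) (begin
        b * T n + ε * T n            ≡⟨ solve 3 (λ b ε t → b :* t :+ ε :* t := (b :+ ε) :* t) refl b ε (T n) ⟩
        (b + ε) * T n                ≤⟨ proj₁ (fast n) ⟩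
        T (suc n)                    ≤⟨ T≤b′T+bʲ n ⟩
        b′ * T n + b ^ʳ n * T 1      ≤⟨ +-mono-≤ _ (*-monoˡ-≤ (T n) (proj₁ (0<T n)) b′≤b) ⟩
        b * T n + b ^ʳ n * T 1       ∎)
      bound : b ^ʳ n * (ε * T 0 * κ ^ʳ n) ≤ b ^ʳ n * T 1
      bound = begin
        b ^ʳ n * (ε * T 0 * κ ^ʳ n)   ≡⟨ solve 4 (λ p ε t k → p :* (ε :* t :* k) := ε :* ((p :* k) :* t)) refl (b ^ʳ n) ε (T 0) (κ ^ʳ n) ⟩
        ε * (b ^ʳ n * κ ^ʳ n * T 0)   ≡⟨ cong (λ p → ε * (p * T 0)) (^-distrib-* b κ n) ⟨
        ε * ((b * κ) ^ʳ n * T 0)      ≡⟨ cong (λ p → ε * (p ^ʳ n * T 0)) bκ ⟩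
        ε * ((b + ε) ^ʳ n * T 0)      ≤⟨ *-monoʳ-≤ ε (proj₁ 0<ε) (fast⇒^≤T (proj₁ ∘ fast) n) ⟩
        ε * T n                       ≤⟨ εT≤ ⟩
        b ^ʳ n * T 1                  ∎

    -- One slow step occurs by `¬always-fast`, and `slow-suc` passes slowness on.
    eventually-slow : ∃[ J ] (∀ j → T (suc (j ℕ.+ J)) ≤ (b + ε) * T (j ℕ.+ J))
    eventually-slow with em {P = ∃[ J ] T (suc J) ≤ (b + ε) * T J}
    ... | no never        = contradiction (λ j → ≰⇒> λ p → never (j , p)) ¬always-fast
    ... | yes (J , slow₀) = J , slow
      where
      slow : ∀ j → T (suc (j ℕ.+ J)) ≤ (b + ε) * T (j ℕ.+ J)
      slow zero    = slow₀
      slow (suc j) = slow-suc (j ℕ.+ J) (slow j)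

-- Counting points and the pigeonhole argument on colours.

module Counting (em : ExcludedMiddle 0ℓ) where
  open import Data.Nat.Base using (_≤_; _<_; _+_; _*_; _^_)

  indicator : Set → ℕ
  indicator P with em {P = P}
  ... | yes _ = 1
  ... | no _  = 0

  indicator-true : ∀ {P} → P → indicator P ≡ 1
  indicator-true {P} p with em {P = P}
  ... | yes _ = refl
  ... | no ¬p = contradiction p ¬p

  indicator-false : ∀ {P} → ¬ P → indicator P ≡ 0
  indicator-false {P} ¬p with em {P = P}
  ... | yes p = contradiction p ¬p
  ... | no _  = refl

  indicator-∪ : ∀ {P Q R} → (P → Q ⊎ R) → indicator P ≤ indicator Q + indicator R
  indicator-∪ {P} {Q} {R} f with em {P = P}
  ... | no _  = z≤n
  ... | yes p with f p
  ...   | inj₁ q = ℕ.≤-trans (ℕ.≤-reflexive (sym (indicator-true q))) (ℕ.m≤m+n (indicator Q) (indicator R))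
  ...   | inj₂ r = ℕ.≤-trans (ℕ.≤-reflexive (sym (indicator-true r))) (ℕ.m≤n+m (indicator R) (indicator Q))

  -- A point is a ray with the exponent of a grid distance on it.
  PointSet : Set₁
  PointSet = Fin 2 → ℕ → Set

  count : PointSet → ℕ → ℕ
  count P zero    = 0
  count P (suc n) = indicator (P zero n) + indicator (P (suc zero) n) + count P n

  count-∪ : ∀ {P Q R : PointSet} n → (∀ e m → m < n → P e m → Q e m ⊎ R e m) → count P n ≤ count Q n + count R n
  count-∪         zero    f = z≤n
  count-∪ {P} {Q} {R} (suc n) f = ℕ.≤-trans
    (ℕ.+-mono-≤ (ℕ.+-mono-≤ (indicator-∪ (f zero n ℕ.≤-refl)) (indicator-∪ (f (suc zero) n ℕ.≤-refl)))
                (count-∪ n λ e m m<n → f e m (ℕ.m<n⇒m<1+n m<n)))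
    (ℕ.≤-reflexive (+-*-Solver.solve 6 (λ a b c d x y →
      a :+ b :+ (c :+ d) :+ (x :+ y) := a :+ c :+ x :+ (b :+ d :+ y)) refl
      (indicator (Q zero n)) (indicator (R zero n)) (indicator (Q (suc zero) n)) (indicator (R (suc zero) n))
      (count Q n) (count R n)))
    where open +-*-Solver using (_:+_; _:=_)

  count-∅ : ∀ {P : PointSet} n → (∀ e m → ¬ P e m) → count P n ≡ 0
  count-∅ zero    none = refl
  count-∅ (suc n) none = cong₂ _+_
    (cong₂ _+_ (indicator-false (none zero n)) (indicator-false (none (suc zero) n))) (count-∅ n none)

  count-⊆ : ∀ {P Q : PointSet} n → (∀ e m → m < n → P e m → Q e m) → count P n ≤ count Q n
  count-⊆ {P} {Q} n f = ℕ.≤-trans (count-∪ {R = λ _ _ → ⊥} n λ e m m<n p → inj₁ (f e m m<n p))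
    (ℕ.≤-reflexive (trans (cong (count Q n +_) (count-∅ n λ _ _ ())) (ℕ.+-identityʳ (count Q n))))

  count-all : ∀ {P : PointSet} → (∀ e m → P e m) → ∀ n → count P n ≡ 2 * n
  count-all all zero    = refl
  count-all {P} all (suc n) = trans
    (cong₂ _+_ (cong₂ _+_ (indicator-true (all zero n)) (indicator-true (all (suc zero) n))) (count-all all n))
    (sym (ℕ.*-suc 2 n))

  -- The colour is fixed bit by bit; each bit keeps the larger of two classes, hence at least half
  -- of the points.
  pigeonhole : ∀ k (P : PointSet) (colour : Fin 2 → ℕ → Vec Bool k) n →
               ∃[ h ] count P n ≤ 2 ^ k * count (λ e m → P e m × colour e m ≡ h) n
  pigeonhole zero    P colour n = [] , ℕ.≤-trans (count-⊆ n λ e m _ p → p , only (colour e m))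
                                                 (ℕ.≤-reflexive (sym (ℕ.*-identityˡ _)))
    where
    only : (v : Vec Bool 0) → v ≡ []
    only [] = refl
  pigeonhole (suc k) P colour n = choose (ℕ.≤-total (count (P₁ true) n) (count (P₁ false) n))
    where
    P₁ : Bool → PointSet
    P₁ c e m = P e m × head (colour e m) ≡ c
    split : count P n ≤ count (P₁ true) n + count (P₁ false) n
    split = count-∪ n λ e m _ p → by-head p (head (colour e m)) refl
      where
      by-head : ∀ {e m} → P e m → ∀ c → head (colour e m) ≡ c → P₁ true e m ⊎ P₁ false e m
      by-head p true  eq = inj₁ (p , eq)
      by-head p false eq = inj₂ (p , eq)
    larger : ∀ c → count P n ≤ 2 * count (P₁ c) n →
             ∃[ h ] count P n ≤ 2 ^ suc k * count (λ e m → P e m × colour e m ≡ h) n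
    larger c P≤ = let h , P₁≤ = pigeonhole k (P₁ c) (λ e m → tail (colour e m)) n in
      c ∷ h , (begin
        count P n
          ≤⟨ P≤ ⟩
        2 * count (P₁ c) n
          ≤⟨ ℕ.*-monoʳ-≤ 2 P₁≤ ⟩
        2 * (2 ^ k * count (λ e m → P₁ c e m × tail (colour e m) ≡ h) n)
          ≡⟨ ℕ.*-assoc 2 (2 ^ k) _ ⟨
        2 ^ suc k * count (λ e m → P₁ c e m × tail (colour e m) ≡ h) n
          ≤⟨ ℕ.*-monoʳ-≤ (2 ^ suc k) (count-⊆ n λ e m _ ((p , c≡) , h≡) → p , uncons (colour e m) c≡ h≡) ⟩
        2 ^ suc k * count (λ e m → P e m × colour e m ≡ c ∷ h) n
          ∎)
      where
      open ℕ.≤-Reasoning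
      uncons : ∀ {h} (v : Vec Bool (suc k)) → head v ≡ c → tail v ≡ h → v ≡ c ∷ h
      uncons (_ ∷ _) refl refl = refl
    choose : count (P₁ true) n ≤ count (P₁ false) n ⊎ count (P₁ false) n ≤ count (P₁ true) n →
             ∃[ h ] count P n ≤ 2 ^ suc k * count (λ e m → P e m × colour e m ≡ h) n
    choose (inj₁ t≤f) = larger false (ℕ.≤-trans split (ℕ.+-mono-≤ t≤f (ℕ.m≤m+n (count (P₁ false) n) 0)))
    choose (inj₂ f≤t) = larger true (ℕ.≤-trans split (ℕ.+-monoʳ-≤ (count (P₁ true) n) (ℕ.m≤n⇒m≤n+o 0 f≤t)))

  -- Serves all advice strings at once, with the order of the reals for grid scales and that of ℕ
  -- for additive constants.
  directed-bound : ∀ {X : Set} (_≼_ : X → X → Set) → (∀ {x y z} → x ≼ y → y ≼ z → x ≼ z) →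
            (∀ x → x ≼ x) → (∀ x y → ∃[ z ] (x ≼ z × y ≼ z)) →
            ∀ k (f : Vec Bool k → X) → ∃[ u ] (∀ h → f h ≼ u)
  directed-bound _≼_ ≼-trans ≼-refl ub zero    f = f [] , λ { [] → ≼-refl (f []) }
  directed-bound _≼_ ≼-trans ≼-refl ub (suc k) f =
    let u , f≼u = directed-bound _≼_ ≼-trans ≼-refl ub k (f ∘ (true ∷_))
        v , f≼v = directed-bound _≼_ ≼-trans ≼-refl ub k (f ∘ (false ∷_))
        w , u≼w , v≼w = ub u v
    in w , λ { (true ∷ h) → ≼-trans (f≼u h) u≼w ; (false ∷ h) → ≼-trans (f≼v h) v≼w }

  upper-bound-ℕ : ∀ k (f : Vec Bool k → ℕ) → ∃[ u ] (∀ h → f h ≤ u)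
  upper-bound-ℕ = directed-bound _≤_ ℕ.≤-trans (λ _ → ℕ.≤-refl) λ m n → m ℕ.⊔ n , ℕ.m≤m⊔n m n , ℕ.m≤n⊔m m n

  -- By pigeonhole, some colour class has N / q of the 2N points with N = 1 + E K.
  colour-contradiction : ∀ {k q} → 2 ^ k ≡ suc q → (colour : Fin 2 → ℕ → Vec Bool (suc k)) → ∀ E K →
    ¬ (∀ h N → E * (count (λ e m → ⊤ × colour e m ≡ h) N * suc q) + N * suc q ≤ E * (N + K))
  colour-contradiction {k} {q} 2^k≡q colour E K bound = from-popular (pigeonhole (suc k) (λ _ _ → ⊤) colour N)
    where
    open ℕ.≤-Reasoning
    N = suc (E * K)
    from-popular : ¬ (∃[ h ] count (λ _ _ → ⊤) N ≤ 2 ^ suc k * count (λ e m → ⊤ × colour e m ≡ h) N)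
    -- As `N ≤ c * suc q`, the assumed bound leaves `N * suc q ≤ E * K`, which is less than `N`.
    from-popular (h , popular) = ℕ.<⇒≱ (ℕ.m≤m*n N (suc q)) (ℕ.+-cancelˡ-≤ (E * N) (N * suc q) (E * K) (begin
      E * N + N * suc q             ≤⟨ ℕ.+-monoˡ-≤ (N * suc q) (ℕ.*-monoʳ-≤ E N≤cq) ⟩
      E * (c * suc q) + N * suc q   ≤⟨ bound h N ⟩
      E * (N + K)                   ≡⟨ ℕ.*-distribˡ-+ E N K ⟩
      E * N + E * K                 ∎))
      where
      c = count (λ e m → ⊤ × colour e m ≡ h) N
      N≤cq : N ≤ c * suc q
      N≤cq = ℕ.*-cancelˡ-≤ 2 (begin
        2 * N                  ≡⟨ count-all (λ _ _ → _) N ⟨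
        count (λ _ _ → ⊤) N    ≤⟨ popular ⟩
        2 * 2 ^ k * c          ≡⟨ ℕ.*-assoc 2 (2 ^ k) c ⟩
        2 * (2 ^ k * c)        ≡⟨ cong (2 *_) (trans (cong (_* c) 2^k≡q) (ℕ.*-comm (suc q) c)) ⟩
        2 * (c * suc q)        ∎)

-- Grid points served by the phases of one strategy.

sum-of-shares : ∀ n c J q → (n ℕ.+ c ℕ.+ suc J) ℕ.* q ≡ suc n ℕ.* q ℕ.+ (c ℕ.+ J) ℕ.* q
sum-of-shares = solve 4 (λ n c J q → (n :+ c :+ (con 1 :+ J)) :* q := (con 1 :+ n) :* q :+ (c :+ J) :* q) refl
  where open +-*-Solver

factor-out : ∀ E c J q → E ℕ.* (c ℕ.* q) ℕ.+ E ℕ.* J ℕ.* q ≡ E ℕ.* ((c ℕ.+ J) ℕ.* q)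
factor-out = solve 4 (λ E c J q → E :* (c :* q) :+ E :* J :* q := E :* ((c :+ J) :* q)) refl
  where open +-*-Solver

module Grid (em : ExcludedMiddle 0ℓ) (R : CompleteOrderedField) where
  open OrderedField em R
  open Phases em R using (steps-mono)
  open Counting em
  open ≤-Reasoning

  -- A phase explores a single ray, so an exponent contributes at most one point to its count.
  indicator-ray : ∀ (e : Fin 2) P → let i = indicator (e ≡ zero × P) ℕ.+ indicator (e ≡ suc zero × P) in
                  i ≡ 0 ⊎ (i ≡ 1 × P)
  indicator-ray e P with em {P = P}
  ... | no ¬p = inj₁ (cong₂ ℕ._+_ (indicator-false (¬p ∘ proj₂)) (indicator-false (¬p ∘ proj₂)))
  indicator-ray zero       P | yes p = inj₂ (cong₂ ℕ._+_ (indicator-true (refl , p)) (indicator-false λ ()) , p)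
  indicator-ray (suc zero) P | yes p = inj₂ (cong₂ ℕ._+_ (indicator-false λ ()) (indicator-true (refl , p)) , p)

  -- κ is the ratio of the grid, μ leaves room for the rounding to grid points, and a is slightly larger than b - 1.
  record Constants (q : ℕ) (ρ γ a : ℝ) : Set where
    field
      κ μ σ β : ℝ
      0<γ    : 0# < γ
      0<a    : 0# < a
      0<σ    : 0# < σ
      0<β    : 0# < β
      σρ≡1   : σ * ρ ≡ 1#
      1<κ    : 1# < κ
      κκ≤μ   : κ * κ ≤ μ
      μ^q≤   : μ ^ʳ q ≤ 1# + σ
      γμa≤β  : γ * μ * a ≤ β
      β^q≤   : β ^ʳ q ≤ 1# + a

  module _ {q′ : ℕ} {ρ γ a : ℝ} (C : Constants (suc q′) ρ γ a) where
    open Constants C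

    private
      q : ℕ
      q = suc q′

      0≤κ : 0# ≤ κ
      0≤κ = ≤-trans 0≤1 (proj₁ 1<κ)

      κ≤μ : κ ≤ μ
      κ≤μ = begin
        κ      ≡⟨ *-identityʳ κ ⟨
        κ * 1# ≤⟨ *-monoʳ-≤ κ 0≤κ (proj₁ 1<κ) ⟩
        κ * κ  ≤⟨ κκ≤μ ⟩
        μ      ∎

      0≤γμ : 0# ≤ γ * μ
      0≤γμ = *-nonneg (proj₁ 0<γ) (≤-trans 0≤κ κ≤μ)

    module _ {T T′ z : ℝ} (0<T : 0# < T) (T+z≤T′ : T + z ≤ T′) (T≤ρz : T ≤ ρ * z) where

      -- Meant for a phase that serves no grid point: as `σ` is the inverse of `ρ`, robustness gives
      -- `σ * T ≤ z`, so `T` still grows by the factor `1# + σ`.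
      μ^qT≤T′ : μ ^ʳ q * T ≤ T′
      μ^qT≤T′ = begin
        μ ^ʳ q * T    ≤⟨ *-monoˡ-≤ T (proj₁ 0<T) μ^q≤ ⟩
        (1# + σ) * T  ≡⟨ solve 2 (λ σ T → (con 1 :+ σ) :* T := T :+ σ :* T) refl σ T ⟩
        T + σ * T     ≤⟨ +-monoʳ-≤ T (*-monoʳ-≤ σ (proj₁ 0<σ) T≤ρz) ⟩
        T + σ * (ρ * z) ≡⟨ cong (T +_) (trans (sym (*-assoc σ ρ z)) (trans (cong (_* z) σρ≡1) (*-identityˡ z))) ⟩
        T + z         ≤⟨ T+z≤T′ ⟩
        T′            ∎

      -- Here `y` is the span of the served points including rounding. Slowness gives `z ≤ a * T`,
      -- hence `y ≤ β`. One factor of `y ^ʳ q` is estimated by `γ * μ * z / T` and the others by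
      -- `β`, so `a * y ^ʳ q * T ≤ β ^ʳ q * z ≤ (1# + a) * z ≤ a * (T + z)`, the last again by `z ≤
      -- a * T`.
      y^qT≤T′ : T′ ≤ (1# + a) * T → ∀ {y} → 0# ≤ y → y * T ≤ γ * μ * z → y ^ʳ q * T ≤ T′
      y^qT≤T′ slow {y} 0≤y yT≤ = ≤-trans (*-cancelˡ-≤ a 0<a (begin
          a * (y * y ^ʳ q′ * T)          ≡⟨ solve 4 (λ a y p T → a :* (y :* p :* T) := a :* (p :* (y :* T))) refl a y (y ^ʳ q′) T ⟩
          a * (y ^ʳ q′ * (y * T))        ≤⟨ *-monoʳ-≤ a (proj₁ 0<a) (*-mono-≤ (*-nonneg 0≤y (proj₁ 0<T)) (^-nonneg q′ 0≤β)
                                             (^-monoˡ-≤ q′ 0≤y y≤β) yT≤) ⟩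
          a * (β ^ʳ q′ * (γ * μ * z))    ≡⟨ solve 4 (λ a p w z → a :* (p :* (w :* z)) := p :* z :* (w :* a)) refl a (β ^ʳ q′) (γ * μ) z ⟩
          β ^ʳ q′ * z * (γ * μ * a)      ≤⟨ *-monoʳ-≤ (β ^ʳ q′ * z) (*-nonneg (^-nonneg q′ 0≤β) 0≤z) γμa≤β ⟩
          β ^ʳ q′ * z * β                ≡⟨ solve 3 (λ p z β → p :* z :* β := β :* p :* z) refl (β ^ʳ q′) z β ⟩
          β ^ʳ q * z                     ≤⟨ *-monoˡ-≤ z 0≤z β^q≤ ⟩
          (1# + a) * z                   ≡⟨ solve 2 (λ a z → (con 1 :+ a) :* z := z :+ a :* z) refl a z ⟩
          z + a * z                      ≤⟨ +-mono-≤ (a * z) z≤aT ⟩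
          a * T + a * z                  ≡⟨ distribˡ a T z ⟨
          a * (T + z)                    ∎))
        T+z≤T′
        where
        0≤β = proj₁ 0<β
        z≤aT : z ≤ a * T
        z≤aT = +-cancelˡ-≤ T (begin
          T + z         ≤⟨ T+z≤T′ ⟩
          T′            ≤⟨ slow ⟩
          (1# + a) * T  ≡⟨ solve 2 (λ a T → (con 1 :+ a) :* T := T :+ a :* T) refl a T ⟩
          T + a * T     ∎)
        0≤z : 0# ≤ z
        0≤z = ≤-trans (*-nonneg (proj₁ 0<σ) (proj₁ 0<T)) (begin
          σ * T         ≤⟨ *-monoʳ-≤ σ (proj₁ 0<σ) T≤ρz ⟩
          σ * (ρ * z)   ≡⟨ trans (sym (*-assoc σ ρ z)) (trans (cong (_* z) σρ≡1) (*-identityˡ z)) ⟩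
          z             ∎)
        y≤β : y ≤ β
        y≤β = *-cancelˡ-≤ T 0<T (begin
          T * y                ≡⟨ *-comm T y ⟩
          y * T                ≤⟨ yT≤ ⟩
          γ * μ * z            ≤⟨ *-monoʳ-≤ (γ * μ) 0≤γμ z≤aT ⟩
          γ * μ * (a * T)      ≡⟨ *-assoc (γ * μ) a T ⟨
          γ * μ * a * T        ≤⟨ *-monoˡ-≤ T (proj₁ 0<T) γμa≤β ⟩
          β * T                ≡⟨ *-comm β T ⟩
          T * β                ∎)

    module _ (T z : ℕ → ℝ) (ray : ℕ → Fin 2)
             (0<T : ∀ j → 0# < T j)
             (T+z≤ : ∀ j → T j + z j ≤ T (suc j))
             (T≤ρz : ∀ j → T j ≤ ρ * z j)
             (T-mono : ∀ j → T j ≤ T (suc j))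
             (slow : ∀ j → T (suc j) ≤ (1# + a) * T j)
             {A : ℝ} (0<A : 0# < A) (T<γA : T 0 < γ * A) where

      grid : ℕ → ℝ
      grid m = κ ^ʳ m * A

      grid-mono : ∀ {m n} → m ℕ.≤ n → grid m ≤ grid n
      grid-mono {m} {n} m≤n = *-monoˡ-≤ A (proj₁ 0<A) (^-monoʳ-≤ {κ} {m} {n} 1<κ m≤n)

      Served : ℕ → PointSet
      Served j e m = ray j ≡ e × T j ≤ γ * grid m × grid m ≤ z j

      Served< : ℕ → PointSet
      Served< J e m = ∃[ j ] (j ℕ.< J × Served j e m)

      -- The `n` served points lie between `T j / γ` and `z j` and span at least n - 1 grid steps;
      -- the further factor `κ` is rounding. The induction carries the bound by `grid N`: a newly
      -- served exponent `N` turns it into both bounds for `suc n`.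
      count-served : ∀ j N → let n = count (Served j) N in
                     n ≡ 0 ⊎ (κ ^ʳ n * T j ≤ γ * grid N × κ ^ʳ n * T j ≤ κ * (γ * z j))
      count-served j zero    = inj₁ refl
      count-served j (suc N) = cases (indicator-ray (ray j) (T j ≤ γ * grid N × grid N ≤ z j)) (count-served j N)
        where
        n = count (Served j) N
        Claim : ℕ → Set
        Claim n = n ≡ 0 ⊎ (κ ^ʳ n * T j ≤ γ * grid (suc N) × κ ^ʳ n * T j ≤ κ * (γ * z j))
        cases : ∀ {i} → i ≡ 0 ⊎ (i ≡ 1 × T j ≤ γ * grid N × grid N ≤ z j) →
                n ≡ 0 ⊎ (κ ^ʳ n * T j ≤ γ * grid N × κ ^ʳ n * T j ≤ κ * (γ * z j)) → Claim (i ℕ.+ n)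
        cases (inj₁ refl) (inj₁ n≡0)      = inj₁ n≡0
        cases (inj₁ refl) (inj₂ (p , p′)) = inj₂ (≤-trans p (*-monoʳ-≤ γ (proj₁ 0<γ) (grid-mono (ℕ.n≤1+n N))) , p′)
        cases (inj₂ (refl , T≤ , ≤z)) below = inj₂ ((begin
            κ * κ ^ʳ n * T j    ≡⟨ *-assoc κ (κ ^ʳ n) (T j) ⟩
            κ * (κ ^ʳ n * T j)  ≤⟨ *-monoʳ-≤ κ 0≤κ κⁿT≤ ⟩
            κ * (γ * grid N)    ≡⟨ solve 4 (λ κ γ p A → κ :* (γ :* (p :* A)) := γ :* (κ :* p :* A)) refl κ γ (κ ^ʳ N) A ⟩
            γ * grid (suc N)    ∎) , (begin
            κ * κ ^ʳ n * T j    ≡⟨ *-assoc κ (κ ^ʳ n) (T j) ⟩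
            κ * (κ ^ʳ n * T j)  ≤⟨ *-monoʳ-≤ κ 0≤κ κⁿT≤ ⟩
            κ * (γ * grid N)    ≤⟨ *-monoʳ-≤ κ 0≤κ (*-monoʳ-≤ γ (proj₁ 0<γ) ≤z) ⟩
            κ * (γ * z j)       ∎))
          where
          κⁿT≤ : κ ^ʳ n * T j ≤ γ * grid N
          κⁿT≤ = from below
            where
            from : n ≡ 0 ⊎ (κ ^ʳ n * T j ≤ γ * grid N × κ ^ʳ n * T j ≤ κ * (γ * z j)) → κ ^ʳ n * T j ≤ γ * grid N
            from (inj₁ n≡0)     = subst (λ n → κ ^ʳ n * T j ≤ γ * grid N) (sym n≡0)
                                    (subst (_≤ γ * grid N) (sym (*-identityˡ (T j))) T≤)
            from (inj₂ (p , _)) = p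

      -- The exponent exceeds the count by one: every phase, even one that serves nothing, wastes
      -- the worth of a grid point. This surplus, for which `μ` leaves room, makes the share
      -- strictly less than 1/q.
      served-step : ∀ j N → (κ ^ʳ suc (count (Served j) N)) ^ʳ q * T j ≤ T (suc j)
      served-step j N = cases (count-served j N)
        where
        n = count (Served j) N
        cases : n ≡ 0 ⊎ (κ ^ʳ n * T j ≤ γ * grid N × κ ^ʳ n * T j ≤ κ * (γ * z j)) → (κ ^ʳ suc n) ^ʳ q * T j ≤ T (suc j)
        cases (inj₁ n≡0) = ≤-trans (*-monoˡ-≤ (T j) (proj₁ (0<T j)) (^-monoˡ-≤ q (^-nonneg (suc n) 0≤κ)
            (subst (λ n → κ ^ʳ suc n ≤ μ) (sym n≡0) (subst (_≤ μ) (sym (*-identityʳ κ)) κ≤μ))))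
          (μ^qT≤T′ (0<T j) (T+z≤ j) (T≤ρz j))
        cases (inj₂ (_ , p)) = y^qT≤T′ (0<T j) (T+z≤ j) (T≤ρz j) (slow j) (^-nonneg (suc n) 0≤κ) (begin
          κ * κ ^ʳ n * T j     ≡⟨ *-assoc κ (κ ^ʳ n) (T j) ⟩
          κ * (κ ^ʳ n * T j)   ≤⟨ *-monoʳ-≤ κ 0≤κ p ⟩
          κ * (κ * (γ * z j))  ≡⟨ solve 3 (λ κ γ z → κ :* (κ :* (γ :* z)) := κ :* κ :* (γ :* z)) refl κ γ (z j) ⟩
          κ * κ * (γ * z j)    ≤⟨ *-monoˡ-≤ (γ * z j) 0≤γz κκ≤μ ⟩
          μ * (γ * z j)        ≡⟨ solve 3 (λ μ γ z → μ :* (γ :* z) := γ :* μ :* z) refl μ γ (z j) ⟩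
          γ * μ * z j          ∎)
          where
          0≤γz : 0# ≤ γ * z j
          0≤γz = *-cancelˡ-≤ κ (<-≤-trans 0<1 (proj₁ 1<κ))
            (subst (_≤ κ * (γ * z j)) (sym (zeroʳ κ)) (≤-trans (*-nonneg (^-nonneg n 0≤κ) (proj₁ (0<T j))) p))

      -- The factors of `served-step` multiply over the phases; the summand `J` collects the surplus
      -- of one per phase.
      served<-bound : ∀ N J → κ ^ʳ ((count (Served< J) N ℕ.+ J) ℕ.* q) * T 0 ≤ T J
      served<-bound N zero    = ≤-reflexive (trans (cong (λ c → κ ^ʳ ((c ℕ.+ 0) ℕ.* q) * T 0)
                                  (count-∅ {Served< 0} N λ { _ _ (_ , () , _) })) (*-identityˡ (T 0)))
      served<-bound N (suc J) = begin
        κ ^ʳ ((c′ ℕ.+ suc J) ℕ.* q) * T 0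
          ≤⟨ *-monoˡ-≤ (T 0) (proj₁ (0<T 0)) (^-monoʳ-≤ {κ} {(c′ ℕ.+ suc J) ℕ.* q} {suc n ℕ.* q ℕ.+ (c ℕ.+ J) ℕ.* q} 1<κ exponent) ⟩
        κ ^ʳ (suc n ℕ.* q ℕ.+ (c ℕ.+ J) ℕ.* q) * T 0
          ≡⟨ cong (_* T 0) (^-homo-* κ (suc n ℕ.* q) ((c ℕ.+ J) ℕ.* q)) ⟩
        κ ^ʳ (suc n ℕ.* q) * κ ^ʳ ((c ℕ.+ J) ℕ.* q) * T 0
          ≡⟨ *-assoc (κ ^ʳ (suc n ℕ.* q)) (κ ^ʳ ((c ℕ.+ J) ℕ.* q)) (T 0) ⟩
        κ ^ʳ (suc n ℕ.* q) * (κ ^ʳ ((c ℕ.+ J) ℕ.* q) * T 0)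
          ≤⟨ *-monoʳ-≤ (κ ^ʳ (suc n ℕ.* q)) (^-nonneg (suc n ℕ.* q) 0≤κ) (served<-bound N J) ⟩
        κ ^ʳ (suc n ℕ.* q) * T J
          ≡⟨ cong (_* T J) (^-assocʳ κ (suc n) q) ⟨
        (κ ^ʳ suc n) ^ʳ q * T J
          ≤⟨ served-step J N ⟩
        T (suc J) ∎
        where
        c = count (Served< J) N
        c′ = count (Served< (suc J)) N
        n = count (Served J) N
        c′≤n+c : c′ ℕ.≤ n ℕ.+ c
        c′≤n+c = count-∪ N λ { e m _ (j , s≤s j≤J , s) → split {j} {e} {m} j≤J s }
          where
          split : ∀ {j e m} → j ℕ.≤ J → Served j e m → Served J e m ⊎ Served< J e m
          split {j} j≤J s with ℕ.m≤n⇒m<n∨m≡n j≤J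
          ... | inj₁ j<J  = inj₂ (j , j<J , s)
          ... | inj₂ refl = inj₁ s
        exponent : (c′ ℕ.+ suc J) ℕ.* q ℕ.≤ suc n ℕ.* q ℕ.+ (c ℕ.+ J) ℕ.* q
        exponent = ℕ.≤-trans (ℕ.*-monoˡ-≤ q (ℕ.+-monoˡ-≤ (suc J) c′≤n+c)) (ℕ.≤-reflexive
          (sum-of-shares n c J q))

      -- The case `N = 0` of the preceding bound, with count zero; it makes `T` unbounded.
      κᴶT≤T : ∀ J → κ ^ʳ J * T 0 ≤ T J
      κᴶT≤T J = ≤-trans (*-monoˡ-≤ (T 0) (proj₁ (0<T 0)) (^-monoʳ-≤ {κ} {J} {J ℕ.* q} 1<κ (ℕ.m≤m*n J q)))
                        (served<-bound 0 J)

      -- A phase spans at most `E` grid steps, which bounds the number of phases from below.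
      T≤[κᴱ]ᴶT : ∀ {E} → 1# + a ≤ κ ^ʳ E → ∀ J → T J ≤ κ ^ʳ (E ℕ.* J) * T 0
      T≤[κᴱ]ᴶT {E} 1+a≤κᴱ J = subst (λ p → T J ≤ p * T 0) (^-assocʳ κ E J) (go J)
        where
        go : ∀ J → T J ≤ (κ ^ʳ E) ^ʳ J * T 0
        go zero    = ≤-reflexive (sym (*-identityˡ (T 0)))
        go (suc J) = begin
          T (suc J)                          ≤⟨ slow J ⟩
          (1# + a) * T J                     ≤⟨ *-mono-≤ (proj₁ (0<T J)) (^-nonneg E 0≤κ) 1+a≤κᴱ (go J) ⟩
          κ ^ʳ E * ((κ ^ʳ E) ^ʳ J * T 0)     ≡⟨ *-assoc (κ ^ʳ E) ((κ ^ʳ E) ^ʳ J) (T 0) ⟨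
          (κ ^ʳ E) ^ʳ suc J * T 0            ∎

      -- Only phases up to the index `J` at which `T` crosses `γ * grid N` can serve exponents below
      -- `N`. Count and surpluses, taken `q` times, fit into `N + K` grid steps (`upper`), and there
      -- are at least N / E such phases (`lower`), so the count loses a fixed proportion of `N`.
      count-bound : ∀ {E} → 1# + a ≤ κ ^ʳ E →
                    ∃[ K ] (∀ N (P : PointSet) → (∀ e m → P e m → ∃[ j ] Served j e m) →
                      E ℕ.* (count P N ℕ.* q) ℕ.+ N ℕ.* q ℕ.≤ E ℕ.* (N ℕ.+ K))
      count-bound {E} 1+a≤κᴱ = K , bound
        where
        -- `K` absorbs the quotient of `γ * A` by `T 0` and the overshoot of `T (suc J)`, which is
        -- less than `1# + a` times the limit.
        K = proj₁ (^-unbounded 1<κ ((1# + a) * (γ * A) / T 0))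
        K-large : (1# + a) * (γ * A) ≤ κ ^ʳ K * T 0
        K-large = begin
          (1# + a) * (γ * A)                 ≡⟨ x*[y/x] ((1# + a) * (γ * A)) (0<T 0) ⟨
          T 0 * ((1# + a) * (γ * A) / T 0)   ≤⟨ *-monoʳ-≤ (T 0) (proj₁ (0<T 0)) (proj₂ (^-unbounded 1<κ ((1# + a) * (γ * A) / T 0))) ⟩
          T 0 * κ ^ʳ K                       ≡⟨ *-comm (T 0) (κ ^ʳ K) ⟩
          κ ^ʳ K * T 0                       ∎

        bound : ∀ N (P : PointSet) → (∀ e m → P e m → ∃[ j ] Served j e m) →
                E ℕ.* (count P N ℕ.* q) ℕ.+ N ℕ.* q ℕ.≤ E ℕ.* (N ℕ.+ K)
        bound N P P⊆ = arithmetic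
          where
          limit = γ * grid N
          γκA : limit ≡ κ ^ʳ N * (γ * A)
          γκA = solve 3 (λ γ p A → γ :* (p :* A) := p :* (γ :* A)) refl γ (κ ^ʳ N) A
          T₀<limit : T 0 < limit
          T₀<limit = <-≤-trans T<γA (*-monoʳ-≤ γ (proj₁ 0<γ) (subst (_≤ grid N) (*-identityˡ A) (grid-mono {0} {N} z≤n)))
          J∞ = proj₁ (^-unbounded 1<κ (limit / T 0))
          limit≤T : limit ≤ T J∞
          limit≤T = begin
            limit               ≡⟨ x*[y/x] limit (0<T 0) ⟨
            T 0 * (limit / T 0) ≤⟨ *-monoʳ-≤ (T 0) (proj₁ (0<T 0)) (proj₂ (^-unbounded 1<κ (limit / T 0))) ⟩
            T 0 * κ ^ʳ J∞       ≡⟨ *-comm (T 0) (κ ^ʳ J∞) ⟩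
            κ ^ʳ J∞ * T 0       ≤⟨ κᴶT≤T J∞ ⟩
            T J∞                ∎
          crossing = last-before-change em (λ j → T j < limit) T₀<limit J∞ (λ T< → <⇒≱ T< limit≤T)
          J = proj₁ crossing
          T<limit : T J < limit
          T<limit = proj₁ (proj₂ crossing)
          limit≤T′ : limit ≤ T (suc J)
          limit≤T′ = ≮⇒≥ (proj₂ (proj₂ crossing))
          c = count (Served< (suc J)) N

          count≤c : count P N ℕ.≤ c
          count≤c = count-⊆ N λ e m m<N p → let j , s = P⊆ e m p in j , j<1+J {j} {e} {m} m<N s , s
            where
            j<1+J : ∀ {j e m} → m ℕ.< N → Served j e m → j ℕ.< suc J
            j<1+J {j} {e} {m} m<N (_ , T≤ , _) = ℕ.≰⇒> λ J<j → <⇒≱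
              (*-monoʳ-< γ 0<γ (subst₂ _<_ (*-comm A (κ ^ʳ m)) (*-comm A (κ ^ʳ N))
                (*-monoʳ-< A 0<A (^-mono-< {κ} {m} {N} 1<κ m<N))))
              (≤-trans limit≤T′ (≤-trans (steps-mono T T-mono J<j) T≤))

          upper : (c ℕ.+ suc J) ℕ.* q ℕ.≤ N ℕ.+ K
          upper = ^-cancel-≤ {κ} {(c ℕ.+ suc J) ℕ.* q} {N ℕ.+ K} 1<κ (*-cancelˡ-≤ (T 0) (0<T 0) (begin
            T 0 * κ ^ʳ ((c ℕ.+ suc J) ℕ.* q)   ≡⟨ *-comm (T 0) (κ ^ʳ ((c ℕ.+ suc J) ℕ.* q)) ⟩
            κ ^ʳ ((c ℕ.+ suc J) ℕ.* q) * T 0   ≤⟨ served<-bound N (suc J) ⟩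
            T (suc J)                          ≤⟨ slow J ⟩
            (1# + a) * T J                     ≤⟨ *-monoʳ-≤ (1# + a) (≤-trans 0≤1 (x≤x+y 1# (proj₁ 0<a))) (proj₁ T<limit) ⟩
            (1# + a) * limit                   ≡⟨ trans (cong ((1# + a) *_) γκA)
                                                    (solve 3 (λ b p g → b :* (p :* g) := p :* (b :* g)) refl (1# + a) (κ ^ʳ N) (γ * A)) ⟩
            κ ^ʳ N * ((1# + a) * (γ * A))      ≤⟨ *-monoʳ-≤ (κ ^ʳ N) (^-nonneg N 0≤κ) K-large ⟩
            κ ^ʳ N * (κ ^ʳ K * T 0)            ≡⟨ solve 3 (λ p k t → p :* (k :* t) := t :* (p :* k)) refl (κ ^ʳ N) (κ ^ʳ K) (T 0) ⟩
            T 0 * (κ ^ʳ N * κ ^ʳ K)            ≡⟨ cong (T 0 *_) (^-homo-* κ N K) ⟨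
            T 0 * κ ^ʳ (N ℕ.+ K)               ∎))

          lower : N ℕ.≤ E ℕ.* suc J
          lower = ^-cancel-≤ {κ} {N} {E ℕ.* suc J} 1<κ (*-cancelˡ-≤ (T 0) (0<T 0) (begin
            T 0 * κ ^ʳ N                ≡⟨ *-comm (T 0) (κ ^ʳ N) ⟩
            κ ^ʳ N * T 0                ≤⟨ *-monoʳ-≤ (κ ^ʳ N) (^-nonneg N 0≤κ) (proj₁ T<γA) ⟩
            κ ^ʳ N * (γ * A)            ≡⟨ γκA ⟨
            limit                       ≤⟨ limit≤T′ ⟩
            T (suc J)                   ≤⟨ T≤[κᴱ]ᴶT {E} 1+a≤κᴱ (suc J) ⟩
            κ ^ʳ (E ℕ.* suc J) * T 0    ≡⟨ *-comm (κ ^ʳ (E ℕ.* suc J)) (T 0) ⟩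
            T 0 * κ ^ʳ (E ℕ.* suc J)    ∎))

          arithmetic : E ℕ.* (count P N ℕ.* q) ℕ.+ N ℕ.* q ℕ.≤ E ℕ.* (N ℕ.+ K)
          arithmetic = ℕ.≤-trans
            (ℕ.+-mono-≤ (ℕ.*-monoʳ-≤ E (ℕ.*-monoˡ-≤ q count≤c)) (ℕ.*-monoˡ-≤ q lower))
            (ℕ.≤-trans (ℕ.≤-reflexive (factor-out E c (suc J) q))
              (ℕ.*-monoʳ-≤ E upper))

-- From robustness and consistency to the counting contradiction.

module Bound (em : ExcludedMiddle 0ℓ) (R : CompleteOrderedField) where
  open OrderedField em R
  open Phases em R
  open Counting em
  open Grid em R using (Constants; module Constants; count-bound)
  open Growth em R using (eventually-slow)
  open ≤-Reasoning

  sup-upper : ∀ {I : Set} (i₀ : I) (f : I → ℝ∞) i → f i ≤⁺ sup i₀ f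
  sup-upper i₀ f i = proj₁ (proj₂ (sup-exists i₀ f)) (i , refl)

  -- A missed target has ratio `⊤⁺`, which the finite bound rules out. Otherwise the bound is
  -- multiplied by the distance, and the final walk to the target cancels.
  ratio⇒finds : ∀ {d₀} → 0# < d₀ → ∀ {X} {t : Target d₀} {c γ} → ratio X t ≤⁺ [ c ] → c ≤ 1# + 2# * γ →
                Finds X t (γ * Target.dist t)
  ratio⇒finds 0<d₀ {X} {t} {c} {γ} ratio≤c c≤ with em {P = ∃[ n ] FirstReaches X t n} | ratio≤c
  ... | no _            | ()
  ... | yes (n , first) | [ p ]≤ = n , first , *-cancelˡ-≤ 2# 0<2 (+-cancelˡ-≤ δ (begin
    δ + 2# * s              ≡⟨ x*[y/x] (δ + 2# * s) 0<δ ⟨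
    δ * ((δ + 2# * s) / δ)  ≤⟨ *-monoʳ-≤ δ (proj₁ 0<δ) (≤-trans p c≤) ⟩
    δ * (1# + 2# * γ)       ≡⟨ solve 3 (λ δ t γ → δ :* (con 1 :+ t :* γ) := δ :+ t :* (γ :* δ)) refl δ 2# γ ⟩
    δ + 2# * (γ * δ)        ∎))
    where
    δ = Target.dist t
    s = ∑< n (Strategy.x X)
    0<δ : 0# < δ
    0<δ = <-≤-trans 0<d₀ (Target.far t)

  module _ {d₀ ρ b b′ ε γ a : ℝ} (0<d₀ : 0# < d₀) (0<ρ : 0# < ρ)
           (0<b : 0# < b) (b′≤b : b′ ≤ b) (0<b′ : 0# < b′) (0<ε : 0# < ε) (b+ε≡1+a : b + ε ≡ 1# + a)
           (bb′≡ρ : b * b′ ≡ ρ) (b+b′≡ρ : b + b′ ≡ ρ)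
           {q′ : ℕ} (C : Constants (suc q′) ρ γ a) where
    open Constants C using (κ; 1<κ; 0<γ)

    -- The grid points on which `X` achieves ratio at most 1 + 2γ, whatever their advice.
    Profitable : Strategy → ℝ → PointSet
    Profitable X A e m = ∃[ far ] Finds X (target {d₀} e (κ ^ʳ m * A) far) (γ * (κ ^ʳ m * A))

    -- For positive `E` and q = `suc q′` this says that `count P N` is at most N (1/q - 1/E) + K/q.
    CountBound : (X : Strategy) (A : ℝ) (E K : ℕ) → Set₁
    CountBound X A E K = ∀ N (P : PointSet) → (∀ e m → P e m → Profitable X A e m) →
      E ℕ.* (count P N ℕ.* suc q′) ℕ.+ N ℕ.* suc q′ ℕ.≤ E ℕ.* (N ℕ.+ K)

    strategy-bound : ∀ {E} → 1# + a ≤ κ ^ʳ E → ∀ X → ((t : Target d₀) → Finds X t (ρ * Target.dist t)) →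
                     ∃[ B ] (∀ A → B ≤ A → d₀ < A → ∃[ K ] CountBound X A E K)
    strategy-bound {E} 1+a≤κᴱ X finds = B , bound
      where
      open PhaseSequence (Construction.sequence 0<d₀ 0<ρ X finds)

      T-step : ∀ j → T j ≤ T (suc j)
      T-step j = ≤-trans (x≤x+y (T j) (proj₁ (z-pos j))) (T+z≤ j)

      T-mono : ∀ {i j} → i ℕ.≤ j → T i ≤ T j
      T-mono = steps-mono T T-step

      0<T : ∀ j → 0# < T j
      0<T j = <-≤-trans T-pos (T-mono {0} {j} z≤n)

      -- Comes from `T (suc (suc j)) ≤ ρ * z j ≤ ρ * (T (suc j) - T j)`, with `ρ` read both as the
      -- product and as the sum of `b` and `b′`.
      recurrence : ∀ j → T (suc (suc j)) + b * b′ * T j ≤ (b + b′) * T (suc j)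
      recurrence j = begin
        T (suc (suc j)) + b * b′ * T j ≡⟨ cong (λ ρ → T (suc (suc j)) + ρ * T j) bb′≡ρ ⟩
        T (suc (suc j)) + ρ * T j      ≤⟨ +-mono-≤ (ρ * T j) (T≤ρz j) ⟩
        ρ * z j + ρ * T j              ≡⟨ solve 3 (λ ρ z t → ρ :* z :+ ρ :* t := ρ :* (t :+ z)) refl ρ (z j) (T j) ⟩
        ρ * (T j + z j)                ≤⟨ *-monoʳ-≤ ρ (proj₁ 0<ρ) (T+z≤ j) ⟩
        ρ * T (suc j)                  ≡⟨ cong (_* T (suc j)) b+b′≡ρ ⟨
        (b + b′) * T (suc j)           ∎

      settled = eventually-slow T 0<T 0<b b′≤b 0<b′ 0<ε recurrence
      J = proj₁ settled

      B : ℝ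
      -- The first summand gives `T J < γ * A` and, together with the second, `T J < A`.
      B = (T J / γ + 1#) + T J

      T≤ρz₀ : ∀ j → T j ≤ ρ * z j
      T≤ρz₀ j = ≤-trans (≤-trans (T-step j) (T-step (suc j))) (T≤ρz j)

      z≤T : ∀ j → z j ≤ T (suc j)
      z≤T j = ≤-trans (≤-trans (x≤x+y (z j) (proj₁ (0<T j))) (≤-reflexive (+-comm (z j) (T j)))) (T+z≤ j)

      slow : ∀ j → T (suc (j ℕ.+ J)) ≤ (1# + a) * T (j ℕ.+ J)
      slow j = subst (λ c → T (suc (j ℕ.+ J)) ≤ c * T (j ℕ.+ J)) b+ε≡1+a (proj₂ settled j)

      bound : ∀ A → B ≤ A → d₀ < A → ∃[ K ] CountBound X A E K
      bound A B≤A d₀<A = proj₁ K-bound , λ N P P⊆ → proj₂ K-bound N P λ e m p → served e m (P⊆ e m p)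
        where
        0<A : 0# < A
        0<A = <-≤-trans 0<d₀ (proj₁ d₀<A)

        0<T/γ+1 : T J / γ < T J / γ + 1#
        0<T/γ+1 = x<x+y (T J / γ) 0<1

        T<γA : T J < γ * A
        T<γA = subst (_< γ * A) (x*[y/x] (T J) 0<γ) (*-monoʳ-< γ 0<γ
          (<-≤-trans 0<T/γ+1 (≤-trans (x≤x+y (T J / γ + 1#) (proj₁ (0<T J))) B≤A)))

        T<A : T J < A
        T<A = <-≤-trans (subst (T J <_) (+-comm (T J) (T J / γ + 1#))
          (x<x+y (T J) (≤-<-trans (proj₁ (/-pos (0<T J) 0<γ)) 0<T/γ+1))) B≤A

        grid = λ m → κ ^ʳ m * A

        A≤grid : ∀ m → A ≤ grid m
        A≤grid m = subst (_≤ grid m) (*-identityˡ A) (*-monoˡ-≤ A (proj₁ 0<A) (1≤^ m (proj₁ 1<κ)))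

        ServedAt : Fin 2 → ℕ → ℕ → Set
        ServedAt f m j = e j ≡ f × T j ≤ γ * grid m × grid m ≤ z j

        served : ∀ f m → Profitable X A f m → ∃[ j ] ServedAt f m (j ℕ.+ J)
        served f m (far , n , first , S≤) =
          let j , e≡f , T≤S , ≤z = cover (target f (grid m) far) n first T₀<grid (<-≤-trans d₀<A (A≤grid m))
              -- A phase before `J` reaches at most `T J`, which is less than `A`.
              J≤j = ℕ.≮⇒≥ λ j<J → <⇒≱ (<-≤-trans T<A (A≤grid m)) (≤-trans ≤z (≤-trans (z≤T j) (T-mono j<J)))
          in j ℕ.∸ J , subst (ServedAt f m) (sym (ℕ.m∸n+n≡m J≤j)) (e≡f , ≤-trans T≤S S≤ , ≤z)
          where
          T₀<grid : T 0 < grid m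
          T₀<grid = ≤-<-trans (T-mono {0} {J} z≤n) (<-≤-trans T<A (A≤grid m))

        K-bound = count-bound C (λ j → T (j ℕ.+ J)) (λ j → z (j ℕ.+ J)) (λ j → e (j ℕ.+ J))
          (λ j → 0<T (j ℕ.+ J)) (λ j → T+z≤ (j ℕ.+ J)) (λ j → T≤ρz₀ (j ℕ.+ J)) (λ j → T-step (j ℕ.+ J))
          slow 0<A T<γA {E} 1+a≤κᴱ

    module _ {k : ℕ} (S : AdviceStrategy d₀ (suc k)) where
      open AdviceStrategy S

      -- The common scale is fixed first and `K` second, as each `K` depends on `A`.
      uniform-bound : ∀ {E} →
        (∀ h → ∃[ B ] (∀ A → B ≤ A → d₀ < A → ∃[ K ] CountBound (X h) A E K)) →
        ∃[ A ] (d₀ < A × ∃[ K ] (∀ h → CountBound (X h) A E K))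
      uniform-bound {E} bounds = from-scale (directed-bound _≤_ ≤-trans (λ _ → ≤-refl) join (suc k) (proj₁ ∘ bounds))
        where
        join : ∀ x y → ∃[ z ] (x ≤ z × y ≤ z)
        join x y with ≤-total x y
        ... | inj₁ p = y , p , ≤-refl
        ... | inj₂ p = x , ≤-refl , p

        from-K : ∀ {A} → d₀ < A → (∀ h → ∃[ K ] CountBound (X h) A E K) →
                 ∃[ A ] (d₀ < A × ∃[ K ] (∀ h → CountBound (X h) A E K))
        from-K {A} d₀<A K-bounds = let K , ≤K = upper-bound-ℕ (suc k) (proj₁ ∘ K-bounds) in
          A , d₀<A , K , λ h N P P⊆ → ℕ.≤-trans (proj₂ (K-bounds h) N P P⊆) (ℕ.*-monoʳ-≤ E (ℕ.+-monoʳ-≤ N (≤K h)))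

        from-scale : ∃[ M ] (∀ h → proj₁ (bounds h) ≤ M) → ∃[ A ] (d₀ < A × ∃[ K ] (∀ h → CountBound (X h) A E K))
        from-scale (M , ≤M) = let A , M≤A , d₀+1≤A = join M (d₀ + 1#)
                                  d₀<A = <-≤-trans (x<x+y d₀ 0<1) d₀+1≤A
                              in from-K d₀<A λ h → proj₂ (bounds h) A (≤-trans (≤M h) M≤A) d₀<A

      -- The advice colours the grid points, and consistency makes each colour class profitable for
      -- its own strategy, so that each class obeys its `CountBound`.
      ¬all-profitable : ∀ {E A K} → 2 ℕ.^ k ≡ suc q′ → d₀ < A → (∀ h → CountBound (X h) A E K) →
                        ¬ (∀ t → Finds (X (AdviceStrategy.A S t)) t (γ * Target.dist t))
      ¬all-profitable {E} {A} {K} 2^k≡q d₀<A bound consistent =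
        colour-contradiction 2^k≡q (λ e m → AdviceStrategy.A S (point e m)) E K λ h N →
          bound h N _ λ { e m (_ , advice≡h) →
          far m , subst (λ h → Finds (X h) (point e m) (γ * (κ ^ʳ m * A))) advice≡h (consistent (point e m)) }
        where
        far : ∀ m → d₀ ≤ κ ^ʳ m * A
        far m = ≤-trans (proj₁ d₀<A) (subst (_≤ κ ^ʳ m * A) (*-identityˡ A)
                  (*-monoˡ-≤ A (≤-trans (proj₁ 0<d₀) (proj₁ d₀<A)) (1≤^ m (proj₁ 1<κ))))
        point : Fin 2 → ℕ → Target d₀
        point e m = target e (κ ^ʳ m * A) (far m)

      inconsistent : 2 ℕ.^ k ≡ suc q′ → (∀ h t → Finds (X h) t (ρ * Target.dist t)) →
                     ¬ (∀ t → Finds (X (AdviceStrategy.A S t)) t (γ * Target.dist t))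
      inconsistent 2^k≡q robust =
        let E , 1+a≤κᴱ = ^-unbounded 1<κ (1# + a)
            A , d₀<A , K , bound = uniform-bound {E} (λ h → strategy-bound {E} 1+a≤κᴱ (X h) (robust h))
        in ¬all-profitable {E} {A} {K} 2^k≡q d₀<A bound

  -- The gap between `γ * a` and `β` is split at `c`. The part below enlarges `a` to `c / γ`, which
  -- leaves room for `ε`; the part above yields a rounding factor `μ` with `c * μ ≤ β`.
  constants : ∀ q′ {ρ γ a β} → 0# < ρ → 0# < γ → 0# < a → 0# < β → γ * a < β → β ^ʳ suc q′ ≡ 1# + a →
              ∃[ a₁ ] (a < a₁ × Constants (suc q′) ρ γ a₁)
  constants q′ {ρ} {γ} {a} {β} 0<ρ 0<γ 0<a 0<β γa<β β^q≡ =
    let c , γa<c , c<β     = dense γa<β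
        ν , 1<ν , ν^q≤1+σ  = root-below q (x<x+y 1# 0<σ)
        μ , 1<μ , μ≤ν , cμ≤β = slack (<-≤-trans (*-pos 0<γ 0<a) (proj₁ γa<c)) c<β 1<ν
        κ , 1<κ , κκ≤μ     = square-below 1<μ
    in c / γ , a<c/γ γa<c , record
      { κ = κ ; μ = μ ; σ = ρ ⁻¹ ; β = β
      ; 0<γ = 0<γ
      ; 0<a = <-≤-trans 0<a (proj₁ (a<c/γ γa<c))
      ; 0<σ = 0<σ
      ; 0<β = 0<β
      ; σρ≡1 = ⁻¹-inverseˡ 0<ρ
      ; 1<κ = 1<κ
      ; κκ≤μ = κκ≤μ
      ; μ^q≤ = ≤-trans (^-monoˡ-≤ q (≤-trans 0≤1 (proj₁ 1<μ)) μ≤ν) ν^q≤1+σ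
      ; γμa≤β = subst (_≤ β) (sym (γμ[c/γ]≡cμ μ c)) cμ≤β
      ; β^q≤ = ≤-trans (≤-reflexive β^q≡) (+-monoʳ-≤ 1# (proj₁ (a<c/γ γa<c)))
      }
    where
    q = suc q′
    0<σ : 0# < ρ ⁻¹
    0<σ = 0<x⁻¹ 0<ρ

    a<c/γ : ∀ {c} → γ * a < c → a < c / γ
    a<c/γ {c} γa<c = ≰⇒> λ c/γ≤a → <⇒≱ γa<c (subst (_≤ γ * a) (x*[y/x] c 0<γ) (*-monoʳ-≤ γ (proj₁ 0<γ) c/γ≤a))

    γμ[c/γ]≡cμ : ∀ μ c → γ * μ * (c / γ) ≡ c * μ
    γμ[c/γ]≡cμ μ c = trans (solve 3 (λ γ μ a → γ :* μ :* a := γ :* a :* μ) refl γ μ (c / γ)) (cong (_* μ) (x*[y/x] c 0<γ))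

    slack : ∀ {c ν} → 0# < c → c < β → 1# < ν → ∃[ μ ] (1# < μ × μ ≤ ν × c * μ ≤ β)
    slack {c} {ν} 0<c c<β 1<ν with ≤-total ν (β / c)
    ... | inj₁ ν≤β/c = ν , 1<ν , ≤-refl , subst (c * ν ≤_) (x*[y/x] β 0<c) (*-monoʳ-≤ c (proj₁ 0<c) ν≤β/c)
    ... | inj₂ β/c≤ν = β / c , 1<β/c , β/c≤ν , ≤-reflexive (x*[y/x] β 0<c)
      where
      1<β/c : 1# < β / c
      1<β/c = ≰⇒> λ β/c≤1 → <⇒≱ c<β (subst₂ _≤_ (x*[y/x] β 0<c) (*-identityʳ c) (*-monoʳ-≤ c (proj₁ 0<c) β/c≤1))

  -- The two roots of the equation for `b`, and the final contradiction.

  module _ {r : ℝ} where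
    isRoot⇒ : ∀ {x} → IsRoot r x → x * x ≡ ρ r * (x - 1#)
    isRoot⇒ {x} (x≢1 , eq) = begin-equality
      x * x                           ≡⟨ cong (x *_) (*-identityʳ x) ⟨
      x ^ʳ 2                          ≡⟨ x/y*y (x ^ʳ 2) (λ x-1≡0 → x≢1 (x-y≡0⇒x≡y x-1≡0)) ⟨
      x ^ʳ 2 / (x - 1#) * (x - 1#)    ≡⟨ cong (_* (x - 1#)) (x-y≡0⇒x≡y eq) ⟩
      ρ r * (x - 1#)                  ∎

    ⇒isRoot : ∀ {x} → x ≢ 1# → x * x ≡ ρ r * (x - 1#) → IsRoot r x
    ⇒isRoot {x} x≢1 eq = x≢1 , (begin-equality
      x ^ʳ 2 / (x - 1#) - ρ r               ≡⟨ cong (λ p → p / (x - 1#) - ρ r) (trans (cong (x *_) (*-identityʳ x)) eq) ⟩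
      ρ r * (x - 1#) / (x - 1#) - ρ r       ≡⟨ cong (_- ρ r) (x*y/y (ρ r) (λ x-1≡0 → x≢1 (x-y≡0⇒x≡y x-1≡0))) ⟩
      ρ r - ρ r                             ≡⟨ -‿inverseʳ (ρ r) ⟩
      0#                                    ∎)

    -- The two roots b and b′ satisfy (b - 1) (b′ - 1) ≡ 1, hence b b′ ≡ b + b′.
    module _ {b : ℝ} (0<ρ : 0# < ρ r) (largest : IsLargestRoot r b) where
      private
        a = b - 1#
        b²≡ρa = isRoot⇒ (proj₁ largest)

      b≡1+a : b ≡ 1# + a
      b≡1+a = trans (sym (x-y+y b 1#)) (+-comm a 1#)

      -- `ρ r * a ≡ b * b` is nonnegative, and a root differs from `1#`.
      0<a : 0# < a
      0<a = *-cancelˡ-≤ (ρ r) 0<ρ (subst₂ _≤_ (sym (zeroʳ (ρ r))) b²≡ρa (0≤x² b)) ,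
            λ 0≡a → proj₁ (proj₁ largest) (x-y≡0⇒x≡y (sym 0≡a))

      0<b : 0# < b
      0<b = subst (0# <_) (sym b≡1+a) (<-≤-trans 0<1 (x≤x+y 1# (proj₁ 0<a)))

      b′ : ℝ
      b′ = b / a

      0<b′ : 0# < b′
      0<b′ = /-pos 0<b 0<a

      ab′≡b : a * b′ ≡ b
      ab′≡b = x*[y/x] b 0<a

      bb′≡ρ : b * b′ ≡ ρ r
      bb′≡ρ = *-cancelˡ-≡ a 0<a (begin-equality
        a * (b * b′)  ≡⟨ solve 3 (λ a b c → a :* (b :* c) := b :* (a :* c)) refl a b b′ ⟩
        b * (a * b′)  ≡⟨ cong (b *_) ab′≡b ⟩
        b * b         ≡⟨ b²≡ρa ⟩
        ρ r * a       ≡⟨ *-comm (ρ r) a ⟩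
        a * ρ r       ∎)

      b+b′≡bb′ : b + b′ ≡ b * b′
      b+b′≡bb′ = begin-equality
        b + b′               ≡⟨ cong (_+ b′) ab′≡b ⟨
        a * b′ + b′          ≡⟨ solve 2 (λ a c → a :* c :+ c := (con 1 :+ a) :* c) refl a b′ ⟩
        (1# + a) * b′        ≡⟨ cong (_* b′) b≡1+a ⟨
        b * b′               ∎

      b′-root : IsRoot r b′
      b′-root = ⇒isRoot b′≢1 (*-cancelˡ-≡ a 0<a (begin-equality
          a * (b′ * b′)           ≡⟨ *-assoc a b′ b′ ⟨
          a * b′ * b′             ≡⟨ cong (_* b′) ab′≡b ⟩
          b * b′                  ≡⟨ bb′≡ρ ⟩
          ρ r                     ≡⟨ *-identityʳ (ρ r) ⟨
          ρ r * 1#                ≡⟨ cong (ρ r *_) a[b′-1]≡1 ⟨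
          ρ r * (a * (b′ - 1#))   ≡⟨ solve 3 (λ p a i → p :* (a :* i) := a :* (p :* i)) refl (ρ r) a (b′ - 1#) ⟩
          a * (ρ r * (b′ - 1#))   ∎))
        where
        b′≢1 : b′ ≢ 1#
        b′≢1 b′≡1 = proj₂ (x<x+y a 0<1) (begin-equality
          a        ≡⟨ *-identityʳ a ⟨
          a * 1#   ≡⟨ cong (a *_) b′≡1 ⟨
          a * b′   ≡⟨ ab′≡b ⟩
          b        ≡⟨ x-y+y b 1# ⟨
          a + 1#   ∎)
        a[b′-1]≡1 : a * (b′ - 1#) ≡ 1#
        a[b′-1]≡1 = ≤-antisym (+-cancelʳ-≤ a (≤-reflexive eq)) (+-cancelʳ-≤ a (≤-reflexive (sym eq)))
          where
          eq : a * (b′ - 1#) + a ≡ 1# + a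
          eq = begin-equality
            a * (b′ - 1#) + a     ≡⟨ solve 2 (λ a i → a :* i :+ a := a :* (i :+ con 1)) refl a (b′ - 1#) ⟩
            a * (b′ - 1# + 1#)    ≡⟨ cong (a *_) (x-y+y b′ 1#) ⟩
            a * b′                ≡⟨ ab′≡b ⟩
            b                     ≡⟨ b≡1+a ⟩
            1# + a                ∎

      -- Maximality of `b` enters here; it supplies the order of the characteristic roots that the
      -- growth estimate relies on.
      b′≤b : b′ ≤ b
      b′≤b = proj₂ largest b′-root

  9≤r⇒0<ρ : ∀ {r} → fromℕ 9 ≤ r → 0# < ρ r
  9≤r⇒0<ρ {r} 9≤r = /-pos (0<y-x (<-≤-trans (x<x+y 1# (<-≤-trans 0<1 (x≤x+y 1# (0≤fromℕ 7)))) 9≤r)) 0<2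
    where
    0≤fromℕ : ∀ n → 0# ≤ fromℕ n
    0≤fromℕ zero    = ≤-refl
    0≤fromℕ (suc n) = ≤-trans 0≤1 (x≤x+y 1# (0≤fromℕ n))

  -- `γ₀` corresponds to `c` exactly but need not be positive; it is raised within the gap below
  -- `x`.
  positive-between : ∀ {c x} → 0# < x → c < 1# + 2# * x → ∃[ γ ] (0# < γ × γ < x × c ≤ 1# + 2# * γ)
  positive-between {c} {x} 0<x c< = choose (≤-total γ₀ 0#)
    where
    γ₀ = (c - 1#) / 2#
    c≤ : ∀ {γ} → γ₀ ≤ γ → c ≤ 1# + 2# * γ
    c≤ γ₀≤γ = ≤-trans (≤-reflexive (x≡1+2[x-1]/2 c)) (+-monoʳ-≤ 1# (*-monoʳ-≤ 2# (proj₁ 0<2) γ₀≤γ))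
    γ₀<x : γ₀ < x
    γ₀<x = ≰⇒> λ x≤γ₀ → <⇒≱ c< (subst (1# + 2# * x ≤_) (sym (x≡1+2[x-1]/2 c))
      (+-monoʳ-≤ 1# (*-monoʳ-≤ 2# (proj₁ 0<2) x≤γ₀)))
    choose : γ₀ ≤ 0# ⊎ 0# ≤ γ₀ → ∃[ γ ] (0# < γ × γ < x × c ≤ 1# + 2# * γ)
    choose (inj₁ γ₀≤0) = let γ , 0<γ , γ<x = dense 0<x in γ , 0<γ , γ<x , c≤ (≤-trans γ₀≤0 (proj₁ 0<γ))
    choose (inj₂ 0≤γ₀) = let γ , γ₀<γ , γ<x = dense γ₀<x in γ , ≤-<-trans 0≤γ₀ γ₀<γ , γ<x , c≤ (proj₁ γ₀<γ)

  consistency-bound : ∀ k {d₀ r b β c} → 0# < d₀ → fromℕ 9 ≤ r → IsLargestRoot r b → IsPositiveRoot (2 ℕ.^ k) b β →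
    (S : AdviceStrategy d₀ (suc k)) → let open AdviceStrategy S in
    (∀ h t → ratio (X h) t ≤⁺ [ r ]) → (∀ t → ratio (X (A t)) t ≤⁺ [ c ]) → ¬ (c < 1# + 2# * (β / (b - 1#)))
  consistency-bound k {d₀} {r} {b} {β} {c} 0<d₀ 9≤r largest (0<β , β^q≡b) S robust consistent c< =
    let γ , 0<γ , γ<β/a , c≤ = positive-between (/-pos 0<β 0<a′) c<
        γa<β = subst₂ _<_ (*-comm a γ) (x*[y/x] β 0<a′) (*-monoʳ-< a 0<a′ γ<β/a)
        a₁ , a<a₁ , C = constants q′ 0<ρ 0<γ 0<a′ 0<β γa<β
                          (trans (trans (cong (β ^ʳ_) (sym q≡)) β^q≡b) (b≡1+a 0<ρ largest))
    in inconsistent 0<d₀ 0<ρ (0<b 0<ρ largest) (b′≤b 0<ρ largest) (0<b′ 0<ρ largest) (0<y-x a<a₁) (b+ε≡1+a₁ a₁)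
         (bb′≡ρ 0<ρ largest) (trans (b+b′≡bb′ 0<ρ largest) (bb′≡ρ 0<ρ largest)) C S q≡
         (λ h t → ratio⇒finds 0<d₀ {X h} (robust h t) (≤-reflexive (x≡1+2[x-1]/2 r)))
         (λ t → ratio⇒finds 0<d₀ {X (A t)} (consistent t) c≤)
    where
    open AdviceStrategy S
    a = b - 1#
    q′ = ℕ.pred (2 ℕ.^ k)
    q≡ : 2 ℕ.^ k ≡ suc q′
    q≡ = sym (ℕ.suc-pred (2 ℕ.^ k) ⦃ ℕ.m^n≢0 2 k ⦄)
    0<ρ = 9≤r⇒0<ρ 9≤r
    0<a′ = 0<a 0<ρ largest
    b+ε≡1+a₁ : ∀ a₁ → b + (a₁ - a) ≡ 1# + a₁
    b+ε≡1+a₁ a₁ = begin-equality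
      b + (a₁ - a)          ≡⟨ cong (_+ (a₁ - a)) (b≡1+a 0<ρ largest) ⟩
      1# + a + (a₁ - a)     ≡⟨ +-assoc 1# a (a₁ - a) ⟩
      1# + (a + (a₁ - a))   ≡⟨ cong (1# +_) (trans (+-comm a (a₁ - a)) (x-y+y a₁ a)) ⟩
      1# + a₁               ∎

  -- Reduces the claim to refuting a finite consistency below the bound.
  lower-bound : ∀ {x} y → (∀ c → y ≡ [ c ] → ¬ (c < x)) → [ x ] ≤⁺ y
  lower-bound ⊤⁺    _     = [ _ ] ≤⊤⁺
  lower-bound [ c ] ¬c<x = [ ≮⇒≥ (¬c<x c refl) ]≤

theorem4 : (em : ExcludedMiddle 0ℓ) (R : CompleteOrderedField) → let open Search em R in
    (k : ℕ) → 1 ℕ.≤ k →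
    let q = 2 ℕ.^ (k ℕ.∸ 1) in
    (d₀ : ℝ) → 0# < d₀ →
    (r : ℝ) → fromℕ 9 ≤ r →
    (b : ℝ) → IsLargestRoot r b →
    (b^1/q : ℝ) → IsPositiveRoot q b b^1/q →
    (S : AdviceStrategy d₀ k) → IsRobust S r →
    [ 1# + fromℕ 2 * (b^1/q / (b - 1#)) ] ≤⁺ consistency S
theorem4 em R (suc k) _ d₀ 0<d₀ r 9≤r b largest β β-root S robust =
  lower-bound (consistency S) λ c consistency≡c →
    consistency-bound k 0<d₀ 9≤r largest β-root S
      (λ h t → ≤⁺-trans (≤⁺-trans (sup-upper _ (λ h → ratio (X h) t) h) (sup-upper _ _ t)) robust)
      (λ t → subst (ratio (X (A t)) t ≤⁺_) consistency≡c (sup-upper _ _ t))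
  where
  open OrderedField em R
  open Bound em R
  open AdviceStrategy S
  ≤⁺-trans : ∀ {x y z} → x ≤⁺ y → y ≤⁺ z → x ≤⁺ z
  ≤⁺-trans = AddTop.≤⁺-trans _≤_ ≤-trans
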